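{- Let $n \geq 3$ and $d \geq 2$, and let $V(n,d)$ be the number of vertices of $\Omega_n^d$. Then $$V(n,d) \leq \binom{n^d - \lfloor \frac{(n-1)^d+1}{2} \rfloor}{n^d - (n-1)^d} + \binom{n^d - \lfloor \frac{(n-1)^d+2}{2} \rfloor}{n^d - (n-1)^d}.$$
   Context: For integers $n,d \geq 1$ let $I_n^d = \{\alpha = (\alpha_1,\ldots,\alpha_d) : \alpha_i \in \{1,\ldots,n\}\}$. A $d$-dimensional matrix of order $n$ is an array $A = (a_\alpha)_{\alpha \in I_n^d}$ of real numbers, viewed as a point of $\mathbb{R}^{n^d}$. A line of $A$ is the set of entries obtained by fixing all but one coordinate of the index and letting the remaining coordinate range over $\{1,\ldots,n\}$. A matrix is polystochastic if all its entries are nonnegative and the sum of entries in each line equals $1$. $\Omega_n^d$ denotes the convex polytope of all $d$-dimensional polystochastic matrices of order $n$; a vertex of $\Omega_n^d$ is an extreme point of it. -}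

module Defs where

open import Algebra.Apartness.Structures using (IsHeytingField)
open import Algebra.Bundles using (CommutativeRing)
import Algebra.Definitions.RawMonoid as RawMonoidDefinitions
open import Data.Fin using (Fin)
open import Data.Nat as ℕ using (ℕ)
open import Data.Product using (Σ; _×_; ∃-syntax; proj₁)
open import Data.Sum using (_⊎_)
open import Data.Vec using (Vec; _[_]≔_)
open import Level using (_⊔_) renaming (suc to lsuc)
open import Relation.Binary.Bundles using (Setoid)
open import Relation.Binary.Core using (Rel)
import Relation.Binary.Construct.On as On
open import Relation.Binary.Structures using (IsStrictPartialOrder)
open import Relation.Nullary using (¬_)

-- The real numbers, axiomatically: a Cauchy-complete Archimedean ordered field.
-- Classically this determines ℝ up to unique isomorphism.  The axioms are in
-- their constructive form (no trichotomy is assumed, only cotransitivity and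
-- tightness of the apartness x < y ⊎ y < x), so that they also describe the
-- reals of constructive mathematics.
record RealNumbers c ℓ : Set (lsuc (c ⊔ ℓ)) where
  infix  8 -_
  infixl 7 _*_
  infixl 6 _+_
  infix  4 _≈_ _<_ _≤_
  field
    Carrier : Set c
    _≈_     : Rel Carrier ℓ
    _<_     : Rel Carrier ℓ
    _+_     : Carrier → Carrier → Carrier
    _*_     : Carrier → Carrier → Carrier
    -_      : Carrier → Carrier
    0#      : Carrier
    1#      : Carrier
    isHeytingField       : IsHeytingField _≈_ (λ x y → x < y ⊎ y < x) _+_ _*_ -_ 0# 1#
    isStrictPartialOrder : IsStrictPartialOrder _≈_ _<_
    +-monoˡ-<            : ∀ {x y} z → x < y → x + z < y + z
    *-pos                : ∀ {x y} → 0# < x → 0# < y → 0# < x * y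

  open IsHeytingField isHeytingField public using (isCommutativeRing; _-_)

  commutativeRing : CommutativeRing c ℓ
  commutativeRing = record { isCommutativeRing = isCommutativeRing }

  open RawMonoidDefinitions (CommutativeRing.+-rawMonoid commutativeRing) public
    using (sum) renaming (_×_ to _·_)

  _≤_ : Rel Carrier ℓ
  x ≤ y = ¬ (y < x)

  -- m and k range over all ordered pairs, so this bounds |s m - s k|.
  IsCauchy : (ℕ → Carrier) → Set (c ⊔ ℓ)
  IsCauchy s = ∀ ε → 0# < ε →
    ∃[ N ] (∀ m k → N ℕ.≤ m → N ℕ.≤ k → s m - s k < ε)

  ConvergesTo : (ℕ → Carrier) → Carrier → Set (c ⊔ ℓ)
  ConvergesTo s x = ∀ ε → 0# < ε →
    ∃[ N ] (∀ m → N ℕ.≤ m → (s m - x < ε) × (x - s m < ε))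

  field
    archimedean : ∀ x → ∃[ m ] (x < m · 1#)
    complete    : ∀ s → IsCauchy s → ∃[ x ] ConvergesTo s x

module _ {c ℓ} (ℝ : RealNumbers c ℓ) where

  open RealNumbers ℝ
  private module R = CommutativeRing commutativeRing

  Matrix : (n d : ℕ) → Set c
  Matrix n d = Vec (Fin n) d → Carrier

  matrixSetoid : (n d : ℕ) → Setoid c ℓ
  matrixSetoid n d = record
    { Carrier       = Matrix n d
    ; _≈_           = λ A B → ∀ α → A α ≈ B α
    ; isEquivalence = record
      { refl  = λ α → R.refl
      ; sym   = λ p α → R.sym (p α)
      ; trans = λ p q α → R.trans (p α) (q α)
      }
    }

  -- A line is given by a direction i and an index α whose i-th coordinate
  -- is irrelevant.
  record IsPolystochastic {n d : ℕ} (A : Matrix n d) : Set ℓ where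
    field
      nonNegative : ∀ α → 0# ≤ A α
      lineSum     : ∀ (i : Fin d) (α : Vec (Fin n) d) →
                    sum (λ k → A (α [ i ]≔ k)) ≈ 1#

  record IsVertex {n d : ℕ} (A : Matrix n d) : Set (c ⊔ ℓ) where
    open Setoid (matrixSetoid n d) using () renaming (_≈_ to _≋_)
    field
      isPolystochastic : IsPolystochastic A
      extreme          : ∀ (B C : Matrix n d) (t : Carrier) →
                         IsPolystochastic B → IsPolystochastic C →
                         0# < t → t < 1# →
                         A ≋ (λ α → t * B α + (1# - t) * C α) →
                         (B ≋ A) × (C ≋ A)

  vertexSetoid : (n d : ℕ) → Setoid (c ⊔ ℓ) ℓ
  vertexSetoid n d =
    On.setoid {B = Σ (Matrix n d) IsVertex} (matrixSetoid n d) proj₁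

{-# OPTIONS --safe #-}

-- Put N = n ^ d and D = (n ∸ 1) ^ d, and let φ be a linear functional that
-- separates the given vertices.  By extremality, the coordinates vanishing at a
-- vertex v span the dual of the D-dimensional space of matrices with zero line
-- sums.  So the support S of v has at most N − D elements, and there are D zeros
-- b of v with φ(x) − φ(v) = Σ_b c_b x_b for all polystochastic x.  Let R (lower)
-- collect the b with c_b < 0 and R′ (upper) the others.  Then v minimises φ on
-- the face x_R = 0 and maximises it on the face x_R′ = 0.  Hence R_v is disjoint
-- from S_v but meets S_w whenever φ(w) < φ(v), and the skew Bollobás theorem
-- bounds the number of v with |R_v| ≤ k by the binomial (N − D + k) C (N − D);
-- likewise for R′ with the order reversed.  As |R_v| + |R′_v| = D, every vertex
-- has |R_v| ≤ ⌊D/2⌋ or |R′_v| ≤ ⌊(D − 1)/2⌋, which gives the two summands.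
--
-- The order of ℝ is not decidable, but inequalities of natural numbers are, so
-- the argument takes place under a double negation.

module Submission where

open import Defs
open import Algebra.Apartness.Structures using (IsHeytingField)
open import Algebra.Bundles using (CommutativeRing; RawRing)
import Algebra.Properties.AbelianGroup as AbelianGroupProperties
import Algebra.Properties.CommutativeSemigroup as CommutativeSemigroupProperties
import Algebra.Properties.Ring as RingProperties
import Algebra.Properties.Semiring.Mult.TCOptimised as SemiringMult
import Algebra.Properties.Semiring.Sum as SemiringSum
import Algebra.Solver.Ring as RingSolver
open import Algebra.Solver.Ring.AlmostCommutativeRing
  using (fromCommutativeRing; _-Raw-AlmostCommutative⟶_)
import Algebra.Solver.Ring.NaturalCoefficients.Default as SemiringSolver
open import Data.Empty using (⊥; ⊥-elim)
open import Data.Fin using (Fin; zero; suc; toℕ; combine; remQuot; splitAt; _↑ˡ_; _↑ʳ_; punchIn)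
open import Data.Fin.Induction using (spo-wellFounded)
import Data.Fin.Properties as Fin
open import Data.Fin.Properties
  using (splitAt-↑ˡ; splitAt-↑ʳ; punchInᵢ≢i; remQuot-combine; combine-remQuot; toℕ-injective)
open import Data.List using (List; []; _∷_; _++_; map; length; allFin; filter; cartesianProduct)
open import Data.List.Membership.Propositional using (_∈_)
open import Data.List.Membership.Propositional.Properties
  using (∈-map⁺; ∈-++⁺ˡ; ∈-++⁺ʳ; ∈-++⁻; ∈-filter⁺; ∈-cartesianProduct⁺; ∈-allFin)
open import Data.List.Properties using (length-map; length-++; length-tabulate)
open import Data.List.Relation.Binary.Permutation.Propositional as Perm
  using (_↭_; ↭-refl; ↭-prep; ↭-swap; ↭-trans; ↭-sym)
import Data.List.Relation.Binary.Permutation.Propositional.Properties as ↭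
open import Data.List.Relation.Unary.All as All using (All; []; _∷_)
import Data.List.Relation.Unary.All.Properties as All
open import Data.List.Relation.Unary.Any using (here; there)
open import Data.Maybe.Base using (Maybe; just; nothing)
open import Data.Nat as ℕ using (ℕ; zero; suc)
open import Data.Nat.Combinatorics using (_C_; nCn≡1; nCk+nC[k+1]≡[n+1]C[k+1])
open import Data.Nat.Divisibility using (∣-refl)
import Data.Nat.DivMod as ℕ
import Data.Nat.Properties as ℕ
open import Data.Product using (_×_; _,_; ∃; ∃₂; proj₁; proj₂)
open import Data.Sum using (_⊎_; inj₁; inj₂; [_,_]′; swap)
open import Data.Vec using (Vec; []; _∷_; head; tail; _[_]≔_)
import Data.Vec.Functional as F
open import Function.Base using (_∘_; flip)
open import Function.Bundles using (Injection)
open import Induction.WellFounded using (Acc; acc)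
open import Level using (_⊔_)
open import Relation.Binary.Core using (Rel)
open import Relation.Binary.Definitions using (tri<; tri≈; tri>)
open import Relation.Binary.PropositionalEquality as ≡ using (_≡_)
import Relation.Binary.Reasoning.Setoid as SetoidReasoning
open import Relation.Binary.Structures using (IsStrictPartialOrder)
open import Relation.Nullary using (¬_; yes; no; ¬?)
open import Relation.Nullary.Decidable using (¬¬-excluded-middle; decidable-stable)
open import Relation.Unary using (Decidable)

module _ {c ℓ} (ℝ : RealNumbers c ℓ) where

  -- The commutative ring ℝ and a solver for its identities.

  open RealNumbers ℝ
  open CommutativeRing commutativeRing
    using (ring; semiring; +-abelianGroup; refl; sym; trans; +-cong; +-congˡ; +-congʳ; *-cong; *-congˡ; *-congʳ; -‿cong;
           +-identityˡ; +-identityʳ; *-identityˡ; *-identityʳ; zeroˡ; zeroʳ; distribˡ; distribʳ;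
           +-assoc; +-comm; *-assoc; *-comm; -‿inverseˡ; -‿inverseʳ; reflexive)
  open RingProperties ring using (-0#≈0#; -‿distribˡ-*; -‿distribʳ-*)
  open SemiringSum semiring using (sum-cong-≋; sum-remove; ∑-distrib-+; ∑-comm; *-distribˡ-sum)

  private
    module ≈-Reasoning = SetoidReasoning (CommutativeRing.setoid commutativeRing)
    module ×′ = SemiringMult semiring
    module SR = SemiringSolver (CommutativeRing.commutativeSemiring commutativeRing)

  -- Integer coefficients for the ring solver: the pair (m , n) stands for m − n.
  -- The clause for n = 0 makes the constants 0 and 1 denote 0# and 1# by computation.
  ⟦_⟧ℤ : ℕ × ℕ → Carrier
  ⟦ m , zero  ⟧ℤ = m ×′.× 1#
  ⟦ m , suc n ⟧ℤ = m ×′.× 1# + - (suc n ×′.× 1#)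

  ⟦⟧ℤ-difference : ∀ m n → ⟦ m , n ⟧ℤ ≈ m ×′.× 1# + - (n ×′.× 1#)
  ⟦⟧ℤ-difference m zero    = sym (trans (+-congˡ -0#≈0#) (+-identityʳ _))
  ⟦⟧ℤ-difference m (suc n) = refl

  ⟦⟧ℤ-cancel : ∀ p q → proj₁ p ℕ.+ proj₂ q ≡ proj₁ q ℕ.+ proj₂ p → ⟦ p ⟧ℤ ≈ ⟦ q ⟧ℤ
  ⟦⟧ℤ-cancel (m , n) (m′ , n′) eq = begin
    ⟦ m , n ⟧ℤ                      ≈⟨ ⟦⟧ℤ-difference m n ⟩
    ⌜ m ⌝ + - ⌜ n ⌝                  ≈⟨ add-sub _ _ _ ⟩
    (⌜ m ⌝ + ⌜ n′ ⌝) + (- ⌜ n′ ⌝ + - ⌜ n ⌝)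
      ≈⟨ +-congʳ (trans (sym (×′.×-homo-+ 1# m n′)) (trans (reflexive (≡.cong ⌜_⌝ eq)) (×′.×-homo-+ 1# m′ n))) ⟩
    (⌜ m′ ⌝ + ⌜ n ⌝) + (- ⌜ n′ ⌝ + - ⌜ n ⌝)  ≈⟨ +-congˡ (+-comm _ _) ⟩
    (⌜ m′ ⌝ + ⌜ n ⌝) + (- ⌜ n ⌝ + - ⌜ n′ ⌝)  ≈⟨ add-sub _ _ _ ⟨
    ⌜ m′ ⌝ + - ⌜ n′ ⌝               ≈⟨ ⟦⟧ℤ-difference m′ n′ ⟨
    ⟦ m′ , n′ ⟧ℤ                    ∎
    where
    open ≈-Reasoning
    ⌜_⌝ : ℕ → Carrier
    ⌜ n ⌝ = n ×′.× 1#
    add-sub : ∀ x y z → x + z ≈ (x + y) + (- y + z)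
    add-sub x y z = sym (begin
      (x + y) + (- y + z)
        ≈⟨ SR.solve 4 (λ a b c d → (a SR.:+ b) SR.:+ (c SR.:+ d) SR.:= (a SR.:+ d) SR.:+ (b SR.:+ c))
            refl _ _ _ _ ⟩
      (x + z) + (y + - y)  ≈⟨ +-congˡ (-‿inverseʳ y) ⟩
      (x + z) + 0#         ≈⟨ +-identityʳ _ ⟩
      x + z                ∎)

  -- Cancelling down to a pair with a zero component gives each integer one representative, so that
  -- the normal forms of both sides in the ring solver can agree syntactically and be closed by
  -- `refl`.
  normalise : ℕ × ℕ → ℕ × ℕ
  normalise (suc m , suc n) = normalise (m , n)
  normalise p               = p

  ⟦⟧ℤ-normalise : ∀ p → ⟦ normalise p ⟧ℤ ≈ ⟦ p ⟧ℤ
  ⟦⟧ℤ-normalise (zero  , n)     = refl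
  ⟦⟧ℤ-normalise (suc m , zero)  = refl
  ⟦⟧ℤ-normalise (suc m , suc n) = trans
    (⟦⟧ℤ-normalise (m , n)) (⟦⟧ℤ-cancel (m , n) (suc m , suc n) (ℕ.+-suc m n))

  coefficients : RawRing _ _
  coefficients = record
    { Carrier = ℕ × ℕ
    ; _≈_ = λ p q → ⟦ p ⟧ℤ ≈ ⟦ q ⟧ℤ
    ; _+_ = λ (m , n) (m′ , n′) → normalise (m ℕ.+ m′ , n ℕ.+ n′)
    ; _*_ = λ (m , n) (m′ , n′) → normalise (m ℕ.* m′ ℕ.+ n ℕ.* n′ , m ℕ.* n′ ℕ.+ n ℕ.* m′)
    ; -_  = λ (m , n) → n , m
    ; 0#  = 0 , 0
    ; 1#  = 1 , 0
    }

  -‿+ : ∀ x y → - (x + y) ≈ - x + - y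
  -‿+ x y = sym (AbelianGroupProperties.⁻¹-∙-comm +-abelianGroup x y)

  -‿involutive : ∀ x → - (- x) ≈ x
  -‿involutive = RingProperties.-‿involutive ring

  -‿* : ∀ x y → - x * - y ≈ x * y
  -‿* x y = trans (sym (-‿distribˡ-* x (- y))) (trans (-‿cong (sym (-‿distribʳ-* x y))) (-‿involutive _))

  coefficients⟶ℝ : coefficients -Raw-AlmostCommutative⟶ fromCommutativeRing commutativeRing
  coefficients⟶ℝ = record
    { ⟦_⟧    = ⟦_⟧ℤ
    ; +-homo = λ (m , n) (m′ , n′) → begin
        ⟦ normalise (m ℕ.+ m′ , n ℕ.+ n′) ⟧ℤ         ≈⟨ ⟦⟧ℤ-normalise (m ℕ.+ m′ , n ℕ.+ n′) ⟩
        ⟦ m ℕ.+ m′ , n ℕ.+ n′ ⟧ℤ                     ≈⟨ ⟦⟧ℤ-difference (m ℕ.+ m′) (n ℕ.+ n′) ⟩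
        ⌜ m ℕ.+ m′ ⌝ + - ⌜ n ℕ.+ n′ ⌝
          ≈⟨ +-cong (×′.×-homo-+ 1# m m′) (trans (-‿cong (×′.×-homo-+ 1# n n′)) (-‿+ _ _)) ⟩
        (⌜ m ⌝ + ⌜ m′ ⌝) + (- ⌜ n ⌝ + - ⌜ n′ ⌝)
          ≈⟨ SR.solve 4 (λ a b c d → (a SR.:+ b) SR.:+ (c SR.:+ d) SR.:= (a SR.:+ c) SR.:+ (b SR.:+ d))
              refl _ _ _ _ ⟩
        (⌜ m ⌝ + - ⌜ n ⌝) + (⌜ m′ ⌝ + - ⌜ n′ ⌝)
          ≈⟨ +-cong (⟦⟧ℤ-difference m n) (⟦⟧ℤ-difference m′ n′) ⟨
        ⟦ m , n ⟧ℤ + ⟦ m′ , n′ ⟧ℤ                      ∎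
    ; *-homo = λ (m , n) (m′ , n′) → begin
        ⟦ normalise (m ℕ.* m′ ℕ.+ n ℕ.* n′ , m ℕ.* n′ ℕ.+ n ℕ.* m′) ⟧ℤ
          ≈⟨ ⟦⟧ℤ-normalise (m ℕ.* m′ ℕ.+ n ℕ.* n′ , m ℕ.* n′ ℕ.+ n ℕ.* m′) ⟩
        ⟦ m ℕ.* m′ ℕ.+ n ℕ.* n′ , m ℕ.* n′ ℕ.+ n ℕ.* m′ ⟧ℤ
          ≈⟨ ⟦⟧ℤ-difference (m ℕ.* m′ ℕ.+ n ℕ.* n′) (m ℕ.* n′ ℕ.+ n ℕ.* m′) ⟩
        ⌜ m ℕ.* m′ ℕ.+ n ℕ.* n′ ⌝ + - ⌜ m ℕ.* n′ ℕ.+ n ℕ.* m′ ⌝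
          ≈⟨ +-cong (homo₂ m m′ n n′) (-‿cong (homo₂ m n′ n m′)) ⟩
        (⌜ m ⌝ * ⌜ m′ ⌝ + ⌜ n ⌝ * ⌜ n′ ⌝) + - (⌜ m ⌝ * ⌜ n′ ⌝ + ⌜ n ⌝ * ⌜ m′ ⌝)
          ≈⟨ +-cong (+-congˡ (sym (-‿* _ _))) (trans (-‿+ _ _) (+-cong (-‿distribʳ-* _ _) (-‿distribˡ-* _ _))) ⟩
        (⌜ m ⌝ * ⌜ m′ ⌝ + - ⌜ n ⌝ * - ⌜ n′ ⌝) + (⌜ m ⌝ * - ⌜ n′ ⌝ + - ⌜ n ⌝ * ⌜ m′ ⌝)
          ≈⟨ SR.solve 4 (λ a b c d → (a SR.:* c SR.:+ b SR.:* d) SR.:+ (a SR.:* d SR.:+ b SR.:* c) SR.:=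
              (a SR.:+ b) SR.:* (c SR.:+ d)) refl _ _ _ _ ⟩
        (⌜ m ⌝ + - ⌜ n ⌝) * (⌜ m′ ⌝ + - ⌜ n′ ⌝)
          ≈⟨ *-cong (⟦⟧ℤ-difference m n) (⟦⟧ℤ-difference m′ n′) ⟨
        ⟦ m , n ⟧ℤ * ⟦ m′ , n′ ⟧ℤ ∎
    ; -‿homo = λ (m , n) → begin
        ⟦ n , m ⟧ℤ                ≈⟨ ⟦⟧ℤ-difference n m ⟩
        ⌜ n ⌝ + - ⌜ m ⌝           ≈⟨ +-comm _ _ ⟩
        - ⌜ m ⌝ + ⌜ n ⌝           ≈⟨ +-congˡ (-‿involutive _) ⟨
        - ⌜ m ⌝ + - - ⌜ n ⌝       ≈⟨ -‿+ _ _ ⟨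
        - (⌜ m ⌝ + - ⌜ n ⌝)       ≈⟨ -‿cong (⟦⟧ℤ-difference m n) ⟨
        - ⟦ m , n ⟧ℤ              ∎
    ; 0-homo = refl
    ; 1-homo = refl
    }
    where
    open ≈-Reasoning
    ⌜_⌝ : ℕ → Carrier
    ⌜ n ⌝ = n ×′.× 1#
    homo₂ : ∀ m m′ n n′ → ⌜ m ℕ.* m′ ℕ.+ n ℕ.* n′ ⌝ ≈ ⌜ m ⌝ * ⌜ m′ ⌝ + ⌜ n ⌝ * ⌜ n′ ⌝
    homo₂ m m′ n n′ = trans (×′.×-homo-+ 1# (m ℕ.* m′) (n ℕ.* n′))
                            (+-cong (×′.×1-homo-* m m′) (×′.×1-homo-* n n′))

  coefficients-≟ : ∀ p q → Maybe (⟦ p ⟧ℤ ≈ ⟦ q ⟧ℤ)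
  coefficients-≟ p q with proj₁ p ℕ.+ proj₂ q ℕ.≟ proj₁ q ℕ.+ proj₂ p
  ... | yes eq = just (⟦⟧ℤ-cancel p q eq)
  ... | no  _  = nothing

  module Solver = RingSolver coefficients (fromCommutativeRing commutativeRing) coefficients⟶ℝ coefficients-≟

  open Solver using (solve; _:+_; _:*_; _:-_; :-_; con; _:=_)

  -- Order and apartness

  open IsHeytingField isHeytingField using (#⇒invertible; invertible⇒#; tight; #-cotrans)
  open IsStrictPartialOrder isStrictPartialOrder using (<-respˡ-≈; <-respʳ-≈)
    renaming (irrefl to <-irrefl; trans to <-trans)

  infix 4 _#_
  _#_ : Carrier → Carrier → Set ℓ
  x # y = x < y ⊎ y < x

  infixl 1 _>>=_
  _>>=_ : ∀ {p q} {P : Set p} {Q : Set q} → ¬ ¬ P → (P → ¬ ¬ Q) → ¬ ¬ Q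
  (m >>= f) k = m (λ x → f x k)

  return : ∀ {p} {P : Set p} → P → ¬ ¬ P
  return x k = k x

  #-resp : ∀ {x x′ y y′} → x ≈ x′ → y ≈ y′ → x # y → x′ # y′
  #-resp p q = [ inj₁ ∘ <-respˡ-≈ p ∘ <-respʳ-≈ q , inj₂ ∘ <-respʳ-≈ p ∘ <-respˡ-≈ q ]′

  ≈⇒¬# : ∀ {x y} → x ≈ y → ¬ x # y
  ≈⇒¬# = proj₂ (tight _ _)

  ¬#⇒≈ : ∀ {x y} → ¬ x # y → x ≈ y
  ¬#⇒≈ = proj₁ (tight _ _)

  -- Tightness makes equality a negated statement, so an equation may be proved under a double
  -- negation.
  ≈-stable : ∀ {x y} → ¬ ¬ x ≈ y → x ≈ y
  ≈-stable h = ¬#⇒≈ (λ x#y → h (λ x≈y → ≈⇒¬# x≈y x#y))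

  #⊎≈ : ∀ x y → ¬ ¬ (x # y ⊎ x ≈ y)
  #⊎≈ x y k = k (inj₂ (¬#⇒≈ (k ∘ inj₁)))

  ¬≈⇒¬¬# : ∀ {x y} → ¬ x ≈ y → ¬ ¬ x # y
  ¬≈⇒¬¬# h = h ∘ ¬#⇒≈

  x-0≈x : ∀ x → x - 0# ≈ x
  x-0≈x x = trans (+-congˡ -0#≈0#) (+-identityʳ x)

  inverse : ∀ {x} → x # 0# → ∃ λ y → x * y ≈ 1#
  inverse {x} x#0 = let (y , _ , xy≈1) = #⇒invertible x#0 in
    y , trans (*-congʳ (sym (x-0≈x x))) xy≈1

  invertible⇒#0 : ∀ {x y} → x * y ≈ 1# → x # 0#
  invertible⇒#0 {x} {y} xy≈1 = invertible⇒#
    (y , trans (*-comm _ _) xy′≈1 , xy′≈1)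
    where xy′≈1 = trans (*-congʳ (x-0≈x x)) xy≈1

  *-#0 : ∀ {x y} → x # 0# → y # 0# → x * y # 0#
  *-#0 {x} {y} x#0 y#0 =
    let (x′ , xx′≈1) = inverse x#0; (y′ , yy′≈1) = inverse y#0 in
    invertible⇒#0 {y = x′ * y′} (trans
      (solve 4 (λ x y x′ y′ → (x :* y) :* (x′ :* y′) := (x :* x′) :* (y :* y′)) refl x y x′ y′)
      (trans (*-cong xx′≈1 yy′≈1) (*-identityˡ 1#)))

  *-cancelʳ-0 : ∀ {x y} → y # 0# → x * y ≈ 0# → x ≈ 0#
  *-cancelʳ-0 {x} {y} y#0 xy≈0 = let (y′ , yy′≈1) = inverse y#0 in begin
    x             ≈⟨ *-identityʳ x ⟨
    x * 1#        ≈⟨ *-congˡ yy′≈1 ⟨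
    x * (y * y′)  ≈⟨ *-assoc x y y′ ⟨
    x * y * y′    ≈⟨ *-congʳ xy≈0 ⟩
    0# * y′       ≈⟨ zeroˡ y′ ⟩
    0#            ∎
    where open ≈-Reasoning

  x-y≈0⇒x≈y : ∀ {x y} → x - y ≈ 0# → x ≈ y
  x-y≈0⇒x≈y {x} {y} h = begin
    x            ≈⟨ solve 2 (λ x y → x := (x :- y) :+ y) refl x y ⟩
    (x - y) + y  ≈⟨ +-congʳ h ⟩
    0# + y       ≈⟨ +-identityˡ y ⟩
    y            ∎
    where open ≈-Reasoning

  x≈y⇒x-y≈0 : ∀ {x y} → x ≈ y → x - y ≈ 0#
  x≈y⇒x-y≈0 {x} {y} h = trans (+-congʳ h) (-‿inverseʳ y)

  x<y⇒0<y-x : ∀ {x y} → x < y → 0# < y - x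
  x<y⇒0<y-x {x} x<y = <-respˡ-≈ (-‿inverseʳ x) (+-monoˡ-< (- x) x<y)

  0<y-x⇒x<y : ∀ {x y} → 0# < y - x → x < y
  0<y-x⇒x<y {x} {y} h = <-respˡ-≈ (+-identityˡ x)
    (<-respʳ-≈ (solve 2 (λ x y → (y :- x) :+ x := y) refl x y) (+-monoˡ-< x h))

  x<0⇒0<-x : ∀ {x} → x < 0# → 0# < - x
  x<0⇒0<-x x<0 = <-respʳ-≈ (+-identityˡ _) (x<y⇒0<y-x x<0)

  x-y#0⇒x#y : ∀ {x y} → x - y # 0# → x # y
  x-y#0⇒x#y {x} {y} (inj₁ h) = inj₁ (0<y-x⇒x<y
    (<-respʳ-≈ (solve 2 (λ x y → :- (x :- y) := y :- x) refl x y) (x<0⇒0<-x h)))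
  x-y#0⇒x#y (inj₂ h) = inj₂ (0<y-x⇒x<y h)

  x#y⇒x-y#0 : ∀ {x y} → x # y → x - y # 0#
  x#y⇒x-y#0 {x} {y} (inj₁ h) = inj₁ (<-respʳ-≈ (-‿inverseʳ y) (+-monoˡ-< (- y) h))
  x#y⇒x-y#0 {x} {y} (inj₂ h) = inj₂ (x<y⇒0<y-x h)

  -- Invertible elements are apart from zero, which leaves only 1 < 0 to refute: then (-1)² = 1
  -- would be positive.
  0<1 : 0# < 1#
  0<1 = [ ⊥-elim ∘ 1≮0 , (λ h → h) ]′ (invertible⇒#0 (*-identityˡ 1#))
    where
    1≮0 : ¬ 1# < 0#
    1≮0 1<0 = <-irrefl refl (<-trans 1<0
      (<-respʳ-≈ (trans (-‿* 1# 1#) (*-identityˡ 1#)) (*-pos (x<0⇒0<-x 1<0) (x<0⇒0<-x 1<0))))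

  +-pos : ∀ {x y} → 0# < x → 0# < y → 0# < x + y
  +-pos {x} {y} 0<x 0<y = <-trans 0<y (<-respˡ-≈ (+-identityˡ y) (+-monoˡ-< y 0<x))

  ·1-pos : ∀ k → 0# < suc k · 1#
  ·1-pos zero    = <-respʳ-≈ (sym (+-identityʳ 1#)) 0<1
  ·1-pos (suc k) = +-pos 0<1 (·1-pos k)

  ·1-mono : ∀ {i j} → i ℕ.< j → i · 1# < j · 1#
  ·1-mono {zero}  {suc j} _           = ·1-pos j
  ·1-mono {suc i} {suc j} (ℕ.s≤s i<j) =
    <-respˡ-≈ (+-comm _ _) (<-respʳ-≈ (+-comm _ _) (+-monoˡ-< 1# (·1-mono i<j)))

  ·1-apart : ∀ {i j} → ¬ i ≡ j → i · 1# # j · 1#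
  ·1-apart {i} {j} i≢j with ℕ.<-cmp i j
  ... | tri< i<j _ _ = inj₁ (·1-mono i<j)
  ... | tri≈ _ i≡j _ = ⊥-elim (i≢j i≡j)
  ... | tri> _ _ j<i = inj₂ (·1-mono j<i)

  <-cotrans : ∀ {x y} → x < y → ∀ z → x < z ⊎ z < y
  <-cotrans x<y z with #-cotrans (inj₁ x<y) z
  ... | inj₁ (inj₁ x<z) = inj₁ x<z
  ... | inj₁ (inj₂ z<x) = inj₂ (<-trans z<x x<y)
  ... | inj₂ (inj₁ z<y) = inj₂ z<y
  ... | inj₂ (inj₂ y<z) = inj₁ (<-trans x<y y<z)

  ≤-resp : ∀ {x x′ y y′} → x ≈ x′ → y ≈ y′ → x ≤ y → x′ ≤ y′
  ≤-resp p q h = h ∘ <-respˡ-≈ (sym q) ∘ <-respʳ-≈ (sym p)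

  <⇒≤ : ∀ {x y} → x < y → x ≤ y
  <⇒≤ x<y y<x = <-irrefl refl (<-trans x<y y<x)

  ≈⇒≤ : ∀ {x y} → x ≈ y → x ≤ y
  ≈⇒≤ x≈y y<x = <-irrefl (sym x≈y) y<x

  0≤⇒¬¬ : ∀ {x} → 0# ≤ x → ¬ ¬ (0# < x ⊎ x ≈ 0#)
  0≤⇒¬¬ {x} 0≤x = #⊎≈ x 0# >>= λ where
    (inj₁ (inj₁ x<0)) → ⊥-elim (0≤x x<0)
    (inj₁ (inj₂ 0<x)) → return (inj₁ 0<x)
    (inj₂ x≈0)        → return (inj₂ x≈0)

  -- If x + y < 0, cotransitivity at y gives y < 0 or x + y < y, and the latter yields x < 0.
  +-nonNeg : ∀ {x y} → 0# ≤ x → 0# ≤ y → 0# ≤ x + y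
  +-nonNeg {x} {y} 0≤x 0≤y x+y<0 with <-cotrans x+y<0 y
  ... | inj₂ y<0    = 0≤y y<0
  ... | inj₁ x+y<y = 0≤x (<-respˡ-≈ (solve 2 (λ x y → (x :+ y) :- y := x) refl x y)
                          (<-respʳ-≈ (-‿inverseʳ y) (+-monoˡ-< (- y) x+y<y)))

  -- The goal is a negation, so each factor may be taken to be either positive or zero although this
  -- is not decidable.
  *-nonNeg : ∀ {x y} → 0# ≤ x → 0# ≤ y → 0# ≤ x * y
  *-nonNeg {x} {y} 0≤x 0≤y xy<0 = (0≤⇒¬¬ 0≤x >>= λ p → 0≤⇒¬¬ 0≤y >>= λ q → λ _ → helper p q) (λ x → x)
    where
    helper : 0# < x ⊎ x ≈ 0# → 0# < y ⊎ y ≈ 0# → ⊥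
    helper (inj₁ 0<x) (inj₁ 0<y) = <⇒≤ (*-pos 0<x 0<y) xy<0
    helper (inj₁ _) (inj₂ y≈0) = ≈⇒≤ (sym (trans (*-congˡ y≈0) (zeroʳ x))) xy<0
    helper (inj₂ x≈0) _ = ≈⇒≤ (sym (trans (*-congʳ x≈0) (zeroˡ y))) xy<0

  inverse-pos : ∀ {x y} → 0# < x → x * y ≈ 1# → 0# < y
  inverse-pos {x} {y} 0<x xy≈1 with invertible⇒#0 (trans (*-comm y x) xy≈1)
  ... | inj₂ 0<y = 0<y
  ... | inj₁ y<0 = ⊥-elim (<-irrefl refl (<-trans 0<1
    (0<y-x⇒x<y (<-respʳ-≈ (trans (sym (-‿distribʳ-* x y)) (trans (-‿cong xy≈1) (sym (+-identityˡ _))))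
      (*-pos 0<x (x<0⇒0<-x y<0))))))

  -- Case distinctions on finite lists under double negation, and eventual properties.

  ¬¬-partition : ∀ {x p q} {X : Set x} {P : X → Set p} {Q : X → Set q} →
    (∀ x → ¬ ¬ (P x ⊎ Q x)) → ∀ xs →
    ¬ ¬ ∃₂ λ ys zs → xs ↭ ys ++ zs × All P ys × All Q zs
  ¬¬-partition P⊎Q []       = return ([] , [] , ↭-refl , [] , [])
  ¬¬-partition P⊎Q (x ∷ xs) =
    ¬¬-partition P⊎Q xs >>= λ (ys , zs , xs↭ , ps , qs) → P⊎Q x >>= λ where
      (inj₁ p) → return (x ∷ ys , zs , ↭-prep x xs↭ , p ∷ ps , qs)
      (inj₂ q) → return (ys , x ∷ zs , ↭-trans (↭-prep x xs↭) (↭-sym (↭.shift x ys zs)) , ps , q ∷ qs)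

  ¬¬-all : ∀ {x p} {X : Set x} {P : X → Set p} {xs} → All (λ x → ¬ ¬ P x) xs → ¬ ¬ All P xs
  ¬¬-all []       = return []
  ¬¬-all (p ∷ ps) = p >>= λ p → ¬¬-all ps >>= λ ps → return (p ∷ ps)

  Eventually : ∀ {p} → (ℕ → Set p) → Set p
  Eventually P = ∃ λ k → ∀ t → k ℕ.≤ t → P t

  eventually-all : ∀ {x p} {X : Set x} {P : X → ℕ → Set p} {xs} →
    All (λ x → Eventually (P x)) xs → Eventually (λ t → All (λ x → P x t) xs)
  eventually-all []             = 0 , λ _ _ → []
  eventually-all ((k , p) ∷ ps) = let (k′ , ps) = eventually-all ps in
    k ℕ.⊔ k′ , λ t k≤t → p t (ℕ.≤-trans (ℕ.m≤m⊔n k k′) k≤t) ∷ ps t (ℕ.≤-trans (ℕ.m≤n⊔m k k′) k≤t)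

  -- Linear functionals

  record Linear {X : Set} (f : (X → Carrier) → Carrier) : Set (c ⊔ ℓ) where
    field
      cong        : ∀ {u v} → (∀ i → u i ≈ v i) → f u ≈ f v
      additive    : ∀ u v → f (λ i → u i + v i) ≈ f u + f v
      homogeneous : ∀ t u → f (λ i → t * u i) ≈ t * f u

    zero-vector : ∀ {u} → (∀ i → u i ≈ 0#) → f u ≈ 0#
    zero-vector {u} u≈0 = trans
      (cong (λ i → trans (u≈0 i) (sym (zeroˡ (u i)))))
      (trans (homogeneous 0# u) (zeroˡ (f u)))

  open Linear

  coordinate-linear : {X : Set} (i : X) → Linear (λ u → u i)
  coordinate-linear i = record { cong = λ h → h i ; additive = λ _ _ → refl ; homogeneous = λ _ _ → refl }

  0-linear : {X : Set} → Linear {X} (λ _ → 0#)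
  0-linear = record
    { cong = λ _ → refl ; additive = λ _ _ → sym (+-identityˡ 0#) ; homogeneous = λ t _ → sym (zeroʳ t) }

  axpy-linear : {X : Set} {f g : (X → Carrier) → Carrier} → Linear f → Linear g →
    ∀ a → Linear (λ u → f u + a * g u)
  axpy-linear {f = f} {g} lf lg a = record
    { cong = λ h → +-cong (cong lf h) (*-congˡ (cong lg h))
    ; additive = λ u v → trans (+-cong (additive lf u v) (*-congˡ (additive lg u v)))
        (solve 5 (λ a x y z w → (x :+ y) :+ a :* (z :+ w) := (x :+ a :* z) :+ (y :+ a :* w))
            refl a (f u) (f v) (g u) (g v))
    ; homogeneous = λ t u → trans (+-cong (homogeneous lf t u) (*-congˡ (homogeneous lg t u)))
        (solve 4 (λ a t x y → t :* x :+ a :* (t :* y) := t :* (x :+ a :* y)) refl a t (f u) (g u))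
    }

  ∘-linear : {X Y : Set} {f : (X → Carrier) → Carrier} {E : (Y → Carrier) → X → Carrier} →
    Linear f → (∀ x → Linear (λ y → E y x)) → Linear (f ∘ E)
  ∘-linear lf lE = record
    { cong        = λ h → cong lf (λ x → cong (lE x) h)
    ; additive    = λ u v → trans (cong lf (λ x → additive (lE x) u v)) (additive lf _ _)
    ; homogeneous = λ t u → trans (cong lf (λ x → homogeneous (lE x) t u)) (homogeneous lf t _)
    }

  -- Excluded middle asks for a natural root s. Without one the threshold is 0; otherwise it is s +
  -- 1, because a second root would force q = 0 and then p = 0.
  affine-eventually-nonzero : ∀ p q → ¬ (p ≈ 0# × q ≈ 0#) → ¬ ¬ Eventually (λ t → ¬ (p + t · 1# * q ≈ 0#))
  affine-eventually-nonzero p q ¬0 = ¬¬-excluded-middle >>= λ where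
    (no  ∄t)         → return (0 , λ t _ root → ∄t (t , root))
    (yes (s , root)) → return (suc s , λ t s<t root′ →
      let q≈0 = *-cancelʳ-0 (x#y⇒x-y#0 (inj₂ (·1-mono s<t))) (trans
                  (solve 4 (λ p q s t → q :* (t :- s) := (p :+ t :* q) :- (p :+ s :* q))
                      refl p q (s · 1#) (t · 1#))
                  (x≈y⇒x-y≈0 (trans root′ (sym root))))
      in ¬0 (trans (sym (trans (+-congˡ (trans (*-congˡ q≈0) (zeroʳ _))) (+-identityʳ p))) root , q≈0))

  -- A functional φ that works for us is replaced by φ + t · (i-th coordinate), where
  -- each vector of u ∷ us rules out at most one natural number t.
  generic-functional : {X : Set} (us : List (X → Carrier)) → All (λ u → ¬ (∀ i → u i ≈ 0#)) us →
    ¬ ¬ ∃ λ φ → Linear φ × All (λ u → φ u # 0#) us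
  generic-functional []       []        = return ((λ _ → 0#) , 0-linear , [])
  generic-functional (u ∷ us) (u≉0 ∷ p) =
    generic-functional us p >>= λ (φ , lφ , φ#0) →
    (λ k → u≉0 (λ i → ¬#⇒≈ (λ ui#0 → k (i , ui#0)))) >>= λ (i , ui#0) →
    ¬¬-all {xs = u ∷ us} (affine-eventually-nonzero (φ u) (u i) (λ (_ , e) → ≈⇒¬# e ui#0) ∷
      All.map (λ {v} φv#0 → affine-eventually-nonzero (φ v) (v i) (λ (e , _) → ≈⇒¬# e φv#0)) φ#0) >>= λ evs →
    let (t , nonzero) = eventually-all evs in
    ¬¬-all (All.map ¬≈⇒¬¬# (nonzero t ℕ.≤-refl)) >>= λ nz →
    return ((λ v → φ v + t · 1# * v i) , axpy-linear lφ (coordinate-linear i) (t · 1#) , nz)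

  -- Linear combinations and Gaussian elimination.

  combination : {B : Set} → List (Carrier × B) → (B → Carrier) → Carrier
  combination []             h = 0#
  combination ((t , b) ∷ ps) h = t * h b + combination ps h

  combination-cong : {B : Set} (ps : List (Carrier × B)) {h k : B → Carrier} → (∀ b → h b ≈ k b) →
    combination ps h ≈ combination ps k
  combination-cong []             h≈k = refl
  combination-cong ((t , b) ∷ ps) h≈k = +-cong (*-congˡ (h≈k b)) (combination-cong ps h≈k)

  combination-axpy : {B : Set} (ps : List (Carrier × B)) (s : Carrier) (h k : B → Carrier) →
    combination ps (λ b → s * h b + k b) ≈ s * combination ps h + combination ps k
  combination-axpy [] s h k = sym (trans (+-identityʳ _) (zeroʳ s))
  combination-axpy ((t , b) ∷ ps) s h k = trans (+-congˡ (combination-axpy ps s h k))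
    (solve 6 (λ t s hb kb x y → t :* (s :* hb :+ kb) :+ (s :* x :+ y) := s :* (t :* hb :+ x) :+ (t :* kb :+ y))
      refl t s (h b) (k b) (combination ps h) (combination ps k))

  -- Each entry of `bs` carries its own coefficient, even when repeated, so that splitting `ps` by
  -- sign later splits `bs` without changing the total length.
  Spans : {X B : Set} → (B → (X → Carrier) → Carrier) → List B → Set (c ⊔ ℓ)
  Spans f bs = ∀ g → Linear g → ∃ λ ps → map proj₂ ps ≡ bs × (∀ y → g y ≈ combination ps (λ b → f b y))

  Annihilated : {X B : Set} → (B → (X → Carrier) → Carrier) → List B → Set (c ⊔ ℓ)
  Annihilated f bs = ∃ λ y → ¬ (∀ i → y i ≈ 0#) × All (λ b → f b y ≈ 0#) bs

  find-nonzero : {B : Set} (h : B → Carrier) (bs : List B) →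
    ¬ ¬ (All (λ b → h b ≈ 0#) bs ⊎ ∃₂ λ b bs′ → bs ↭ b ∷ bs′ × h b # 0#)
  find-nonzero h []       = return (inj₁ [])
  find-nonzero h (b ∷ bs) = #⊎≈ (h b) 0# >>= λ where
    (inj₁ hb#0) → return (inj₂ (b , bs , ↭-refl , hb#0))
    (inj₂ hb≈0) → find-nonzero h bs >>= λ where
      (inj₁ all)                  → return (inj₁ (hb≈0 ∷ all))
      (inj₂ (b′ , bs′ , p , hb′#0)) → return (inj₂
        (b′ , b ∷ bs′ , ↭-trans (↭-prep b p) (↭-swap b b′ ↭-refl) , hb′#0))

  e₀ : ∀ {D} → Fin (suc D) → Carrier
  e₀ = 1# F.∷ (λ _ → 0#)

  split-head : ∀ {D} {g : (Fin (suc D) → Carrier) → Carrier} → Linear g →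
    ∀ y → g y ≈ F.head y * g e₀ + g (0# F.∷ F.tail y)
  split-head {g = g} lg y = trans (cong lg eq) (trans (additive lg _ _) (+-congʳ (homogeneous lg _ _)))
    where
    eq : ∀ i → y i ≈ F.head y * e₀ i + (0# F.∷ F.tail y) i
    eq zero    = sym (trans (+-identityʳ _) (*-identityʳ _))
    eq (suc i) = sym (trans (+-congʳ (zeroʳ _)) (+-identityˡ _))

  -- One step of Gaussian elimination: f p is used to eliminate the first coordinate.
  module Pivot {D} {B : Set} (f : B → (Fin (suc D) → Carrier) → Carrier) (lin : ∀ b → Linear (f b))
               (p : B) (w : Carrier) (pw≈1 : f p e₀ * w ≈ 1#) where

    -- Subtracts from `g` the multiple of `f p` that cancels its value at `e₀`; what remains depends
    -- on the other coordinates only.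
    reduce : ((Fin (suc D) → Carrier) → Carrier) → (Fin D → Carrier) → Carrier
    reduce g y = g (0# F.∷ y) + (- (g e₀ * w)) * f p (0# F.∷ y)

    0∷-linear : ∀ {g : (Fin (suc D) → Carrier) → Carrier} → Linear g → Linear (λ y → g (0# F.∷ y))
    0∷-linear lg = ∘-linear lg λ where
      zero    → 0-linear
      (suc i) → coordinate-linear i

    reduce-linear : ∀ {g} → Linear g → Linear (reduce g)
    reduce-linear {g} lg = axpy-linear (0∷-linear lg) (0∷-linear (lin p)) (- (g e₀ * w))

    -- The first coordinate solves the equation `f p` = 0, which identifies the kernel of `f p` with
    -- the space of the remaining coordinates.
    lift : (Fin D → Carrier) → Fin (suc D) → Carrier
    lift y = (- (f p (0# F.∷ y) * w)) F.∷ y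

    lift-reduce : ∀ {g} → Linear g → ∀ y → g (lift y) ≈ reduce g y
    lift-reduce {g} lg y = trans (split-head lg (lift y))
      (solve 4 (λ x w a b → (:- (a :* w)) :* x :+ b := b :+ (:- (x :* w)) :* a) refl
         (g e₀) w (f p (0# F.∷ y)) (g (0# F.∷ y)))

    lift-pivot : ∀ y → f p (lift y) ≈ 0#
    lift-pivot y = trans (lift-reduce (lin p) y) (trans (+-congˡ (*-congʳ (-‿cong pw≈1)))
      (solve 1 (λ a → a :+ (:- con (1 , 0)) :* a := con (0 , 0)) refl (f p (0# F.∷ y))))

    -- The expansion of `reduce g` supplies the coefficients on `bs`; the coefficient of `p` is then
    -- forced by comparing both sides at `e₀`.
    spans-∷ : ∀ bs → Spans (λ b → reduce (f b)) bs → Spans f (p ∷ bs)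
    spans-∷ bs spans g lg = let (ps , ps≡bs , eq) = spans (reduce g) (reduce-linear lg) in
      ((g e₀ - combination ps (λ b → f b e₀)) * w , p) ∷ ps , ≡.cong (p ∷_) ps≡bs , λ y →
      let y₀ = F.head y
          0∷y = 0# F.∷ F.tail y
          Q = combination ps (λ b → f b e₀)
          K = combination ps (λ b → f b 0∷y)
          a = f p 0∷y
      in begin
        g y                                                     ≈⟨ split-head lg y ⟩
        y₀ * g e₀ + g 0∷y
          ≈⟨ solve 5 (λ y₀ x z w a → y₀ :* x :+ z := y₀ :* x :+ (x :* w :* a :+ (z :+ (:- (x :* w)) :* a)))
              refl y₀ (g e₀) (g 0∷y) w a ⟩
        y₀ * g e₀ + (g e₀ * w * a + reduce g (F.tail y))       ≈⟨ +-congˡ (+-congˡ (eq (F.tail y))) ⟩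
        y₀ * g e₀ + (g e₀ * w * a + combination ps (λ b → reduce (f b) (F.tail y)))
          ≈⟨ +-congˡ (+-congˡ (combination-cong ps (λ b →
               solve 4 (λ x w a z → z :+ (:- (x :* w)) :* a := (:- (w :* a)) :* x :+ z)
                   refl (f b e₀) w a (f b 0∷y)))) ⟩
        y₀ * g e₀ + (g e₀ * w * a + combination ps (λ b → (- (w * a)) * f b e₀ + f b 0∷y))
          ≈⟨ +-congˡ (+-congˡ (combination-axpy ps (- (w * a)) (λ b → f b e₀) (λ b → f b 0∷y))) ⟩
        y₀ * g e₀ + (g e₀ * w * a + ((- (w * a)) * Q + K))
          ≈⟨ solve 6 (λ y₀ x w a Q K → y₀ :* x :+ (x :* w :* a :+ ((:- (w :* a)) :* Q :+ K))
                := (x :- Q) :* w :* a :+ y₀ :* (x :- Q) :* con (1 , 0) :+ (y₀ :* Q :+ K))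
                    refl y₀ (g e₀) w a Q K ⟩
        (g e₀ - Q) * w * a + y₀ * (g e₀ - Q) * 1# + (y₀ * Q + K)   ≈⟨ +-congʳ (+-congˡ (*-congˡ pw≈1)) ⟨
        (g e₀ - Q) * w * a + y₀ * (g e₀ - Q) * (f p e₀ * w) + (y₀ * Q + K)
          ≈⟨ +-congʳ (solve 5 (λ k w a y₀ z → k :* w :* a :+ y₀ :* k :* (z :* w) := k :* w :* (y₀ :* z :+ a))
              refl (g e₀ - Q) w a y₀ (f p e₀)) ⟩
        (g e₀ - Q) * w * (y₀ * f p e₀ + a) + (y₀ * Q + K)
          ≈⟨ +-cong (*-congˡ (split-head (lin p) y)) (trans (combination-cong ps (λ b → split-head (lin b) y))
               (combination-axpy ps y₀ (λ b → f b e₀) (λ b → f b 0∷y))) ⟨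
        (g e₀ - Q) * w * f p y + combination ps (λ b → f b y)  ∎
      where open ≈-Reasoning

  -- Induction on the dimension. If all functionals vanish at `e₀`, this vector is annihilated.
  -- Otherwise one of them serves as pivot, and either outcome for the reduced functionals lifts
  -- back. The lemma serves twice: for the zeros of a vertex and for the rank bound in the skew
  -- Bollobás theorem.
  annihilated-or-spans : ∀ {B : Set} D (f : B → (Fin D → Carrier) → Carrier) → (∀ b → Linear (f b)) → ∀ xs →
    ¬ ¬ (Annihilated f xs ⊎ ∃₂ λ bs cs → xs ↭ bs ++ cs × length bs ≡ D × Spans f bs)
  annihilated-or-spans zero f lin xs = return (inj₂ ([] , xs , ↭-refl , ≡.refl , λ g lg →
    [] , ≡.refl , λ y → zero-vector lg λ ()))
  annihilated-or-spans (suc D) f lin xs = find-nonzero (λ b → f b e₀) xs >>= λ where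
    (inj₁ all≈0) → return (inj₁ (e₀ , (λ e₀≈0 → <-irrefl (sym (e₀≈0 zero)) 0<1) , all≈0))
    (inj₂ (p , xs′ , xs↭ , fpe₀#0)) →
      let (w , pw≈1) = inverse fpe₀#0
          open Pivot f lin p w pw≈1
      in annihilated-or-spans D (λ b → reduce (f b)) (λ b → reduce-linear (lin b)) xs′ >>= λ where
        (inj₁ (y , y≉0 , all≈0)) → return (inj₁
          ( lift y
          , (λ ly≈0 → y≉0 (λ i → ly≈0 (suc i)))
          , ↭.All-resp-↭ (↭-sym xs↭) (lift-pivot y ∷ All.map (λ {b} → trans (lift-reduce (lin b) y)) all≈0)))
        (inj₂ (bs , cs , xs′↭ , len , spans)) → return (inj₂
          (p ∷ bs , cs , ↭-trans xs↭ (↭-prep p xs′↭) , ≡.cong suc len , spans-∷ bs spans))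

  -- The skew Bollobás theorem

  private
    variable
      a b m n d : ℕ
      f g : Vec Carrier a → Carrier

  -- y lists the lower coefficients of a monic polynomial of degree a, constant term first.
  monic : Vec Carrier a → Carrier → Carrier
  monic []       x = 1#
  monic (y₀ ∷ y) x = y₀ + x * monic y x

  add-constant : Carrier → Vec Carrier (suc a) → Vec Carrier (suc a)
  add-constant t (y₀ ∷ y) = (t + y₀) ∷ y

  monic-add-constant : ∀ t (y : Vec Carrier (suc a)) x → monic (add-constant t y) x ≈ t + monic y x
  monic-add-constant t (y₀ ∷ y) x = +-assoc t y₀ _

  -- Based on (x - z)(y₀ + x p) = - z y₀ + x (y₀ + (x - z) p), where p is again monic.
  add-root : Carrier → Vec Carrier a → Vec Carrier (suc a)
  add-root z []       = (- z) ∷ []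
  add-root z (y₀ ∷ y) = (- (z * y₀)) ∷ add-constant y₀ (add-root z y)

  monic-add-root : ∀ z (y : Vec Carrier a) x → monic (add-root z y) x ≈ (x - z) * monic y x
  monic-add-root z [] x = solve 2 (λ z x → :- z :+ x :* con (1 , 0) := (x :- z) :* con (1 , 0)) refl z x
  monic-add-root z (y₀ ∷ y) x = trans
    (+-congˡ (*-congˡ (trans (monic-add-constant y₀ (add-root z y) x) (+-congˡ (monic-add-root z y x)))))
    (solve 4 (λ z y₀ x p → :- (z :* y₀) :+ x :* (y₀ :+ (x :- z) :* p) := (x :- z) :* (y₀ :+ x :* p))
        refl z y₀ x (monic y x))

  -- Missing roots are filled up with 0#, supernumerary ones are dropped.
  from-roots : ∀ a → List Carrier → Vec Carrier a
  from-roots zero    zs       = []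
  from-roots (suc a) []       = add-root 0# (from-roots a [])
  from-roots (suc a) (z ∷ zs) = add-root z (from-roots a zs)

  from-roots-#0 : ∀ a {zs x} → x # 0# → All (x #_) zs → monic (from-roots a zs) x # 0#
  from-roots-#0 zero            x#0 x#zs = inj₂ 0<1
  from-roots-#0 (suc a) {[]} {x} x#0 []   = #-resp (sym (monic-add-root 0# (from-roots a []) x)) refl
    (*-#0 (x#y⇒x-y#0 x#0) (from-roots-#0 a x#0 []))
  from-roots-#0 (suc a) {z ∷ zs} {x} x#0 (x#z ∷ x#zs) = #-resp (sym (monic-add-root z (from-roots a zs) x)) refl
    (*-#0 (x#y⇒x-y#0 x#z) (from-roots-#0 a x#0 x#zs))

  from-roots-≈0 : ∀ {zs z} → length zs ℕ.≤ a → z ∈ zs → monic (from-roots a zs) z ≈ 0#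
  from-roots-≈0 {suc a} {z ∷ zs} (ℕ.s≤s h) (here ≡.refl) = trans (monic-add-root z (from-roots a zs) z)
    (trans (*-congʳ (-‿inverseʳ z)) (zeroˡ _))
  from-roots-≈0 {suc a} {z′ ∷ zs} {z} (ℕ.s≤s h) (there z∈zs) = trans (monic-add-root z′ (from-roots a zs) z)
    (trans (*-congˡ (from-roots-≈0 h z∈zs)) (zeroʳ _))

  -- Polynomials of bounded degree in several variables.

  -- Functions that are polynomial of degree at most b in a variables.
  data Polynomial : (a b : ℕ) → (Vec Carrier a → Carrier) → Set (c ⊔ ℓ) where
    const : ∀ t → Polynomial a b (λ _ → t)
    drop  : Polynomial a b f → Polynomial (suc a) b (f ∘ tail)
    var   : Polynomial (suc a) b f → Polynomial (suc a) (suc b) (λ y → head y * f y)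
    add   : Polynomial a b f → Polynomial a b g → Polynomial a b (λ y → f y + g y)
    scale : ∀ t → Polynomial a b f → Polynomial a b (λ y → t * f y)
    resp  : (∀ y → f y ≈ g y) → Polynomial a b f → Polynomial a b g

  weaken : Polynomial a b f → Polynomial a (suc b) f
  weaken (const t)   = const t
  weaken (drop p)    = drop (weaken p)
  weaken (var p)     = var (weaken p)
  weaken (add p q)   = add (weaken p) (weaken q)
  weaken (scale t p) = scale t (weaken p)
  weaken (resp e p)  = resp e (weaken p)

  -- Degree at most one, expressed by the effect of `L` as a factor, because `Polynomial` has no
  -- constructor for general products.
  Affine : ∀ a → (Vec Carrier a → Carrier) → Set (c ⊔ ℓ)
  Affine a L = ∀ {b f} → Polynomial a b f → Polynomial a (suc b) (λ y → L y * f y)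

  -- Multiplication by `L ∘ tail` commutes with every constructor; where the polynomial ignores the
  -- first variable, the hypothesis on `L` applies directly.
  affine-drop : ∀ {L} → Affine a L → Affine (suc a) (L ∘ tail)
  affine-drop L* (const t)   = drop (L* (const t))
  affine-drop L* (drop p)    = drop (L* p)
  affine-drop {L = L} L* (var {f = f} p) = resp
    (λ y → solve 3 (λ l h f → h :* (l :* f) := l :* (h :* f)) refl (L (tail y)) (head y) (f y))
    (var (affine-drop L* p))
  affine-drop {L = L} L* (add p q) = resp (λ y → sym (distribˡ _ _ _))
    (add (affine-drop {L = L} L* p) (affine-drop {L = L} L* q))
  affine-drop {L = L} L* (scale {f = f} t p) = resp
    (λ y → solve 3 (λ l t f → t :* (l :* f) := l :* (t :* f)) refl (L (tail y)) t (f y))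
    (scale t (affine-drop {L = L} L* p))
  affine-drop {L = L} L* (resp e p)  = resp (λ y → *-congˡ (e y)) (affine-drop {L = L} L* p)

  -- At a fixed x the value is affine in the coefficients: the constant term is a variable, and the
  -- rest is x times the same expression in the remaining variables.
  monic-affine : ∀ x → Affine a (λ y → monic y x)
  monic-affine {zero}  x p = resp (λ { [] → sym (*-identityˡ _) }) (weaken p)
  monic-affine {suc a} x {f = f} p = resp
    (λ { (y₀ ∷ y) → solve 4 (λ y₀ x p f → y₀ :* f :+ x :* (p :* f) := (y₀ :+ x :* p) :* f)
        refl y₀ x (monic y x) (f (y₀ ∷ y)) })
    (add (var p) (scale x (affine-drop (monic-affine x) p)))

  ∏monic : List Carrier → Vec Carrier a → Carrier
  ∏monic []       y = 1#
  ∏monic (x ∷ xs) y = monic y x * ∏monic xs y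

  ∏monic-polynomial : ∀ xs → length xs ℕ.≤ b → Polynomial a b (∏monic xs)
  ∏monic-polynomial []       _         = const 1#
  ∏monic-polynomial (x ∷ xs) (ℕ.s≤s h) = monic-affine x (∏monic-polynomial xs h)

  ∏monic-≈0 : ∀ {xs x} {y : Vec Carrier a} → x ∈ xs → monic y x ≈ 0# → ∏monic xs y ≈ 0#
  ∏monic-≈0 (here ≡.refl) h = trans (*-congʳ h) (zeroˡ _)
  ∏monic-≈0 (there x∈xs)  h = trans (*-congˡ (∏monic-≈0 x∈xs h)) (zeroʳ _)

  ∏monic-#0 : ∀ {xs} {y : Vec Carrier a} → All (λ x → monic y x # 0#) xs → ∏monic xs y # 0#
  ∏monic-#0 []       = inj₂ 0<1
  ∏monic-#0 (h ∷ hs) = *-#0 h (∏monic-#0 hs)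

  -- Monomials and moments.

  #monomials : ℕ → ℕ → ℕ
  #monomials zero    b       = 1
  #monomials (suc a) zero    = 1
  #monomials (suc a) (suc b) = #monomials a (suc b) ℕ.+ #monomials (suc a) b

  -- Pascal's rule: a monomial either omits the first variable or is divisible by it, and division
  -- lowers the degree bound by one.
  #monomials≡C : ∀ a b → #monomials a b ≡ (a ℕ.+ b) C b
  #monomials≡C zero    b       = ≡.sym (nCn≡1 b)
  #monomials≡C (suc a) zero    = ≡.refl
  #monomials≡C (suc a) (suc b) = begin
    #monomials a (suc b) ℕ.+ #monomials (suc a) b
      ≡⟨ ≡.cong₂ ℕ._+_ (#monomials≡C a (suc b)) (#monomials≡C (suc a) b) ⟩
    (a ℕ.+ suc b) C suc b ℕ.+ (suc a ℕ.+ b) C b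
      ≡⟨ ≡.cong (λ n → (a ℕ.+ suc b) C suc b ℕ.+ n C b) (ℕ.+-suc a b) ⟨
    (a ℕ.+ suc b) C suc b ℕ.+ (a ℕ.+ suc b) C b
      ≡⟨ ℕ.+-comm ((a ℕ.+ suc b) C suc b) _ ⟩
    (a ℕ.+ suc b) C b ℕ.+ (a ℕ.+ suc b) C suc b
      ≡⟨ nCk+nC[k+1]≡[n+1]C[k+1] (a ℕ.+ suc b) b ⟩
    suc (a ℕ.+ suc b) C suc b ∎
    where open ≡.≡-Reasoning

  -- The sum over i of c i times the k-th monomial (of degree at most b in a variables)
  -- evaluated at ys i.
  moment : ∀ a b → (Fin m → Vec Carrier a) → Fin (#monomials a b) → (Fin m → Carrier) → Carrier
  moment zero    b       ys _ c = sum c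
  moment (suc a) zero    ys _ c = sum c
  moment (suc a) (suc b) ys k c =
    [ (λ k → moment a (suc b) (tail ∘ ys) k c)
    , (λ k → moment (suc a) b ys k (λ i → head (ys i) * c i))
    ]′ (splitAt (#monomials a (suc b)) k)

  sum-linear : Linear {Fin m} sum
  sum-linear = record
    { cong = sum-cong-≋ ; additive = ∑-distrib-+ ; homogeneous = λ t u → sym (*-distribˡ-sum t u) }

  moment-linear : ∀ a b (ys : Fin m → Vec Carrier a) k → Linear (moment a b ys k)
  moment-linear zero    b       ys k = sum-linear
  moment-linear (suc a) zero    ys k = sum-linear
  moment-linear (suc a) (suc b) ys k with splitAt (#monomials a (suc b)) k
  ... | inj₁ k = moment-linear a (suc b) (tail ∘ ys) k
  ... | inj₂ k = ∘-linear (moment-linear (suc a) b ys k) (λ i → record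
    { cong = λ h → *-congˡ (h i)
    ; additive = λ u v → distribˡ _ _ _
    ; homogeneous = λ t u → solve 3 (λ y t u → y :* (t :* u) := t :* (y :* u)) refl (head (ys i)) t (u i)
    })

  Vanishing : ∀ a b → (Fin m → Vec Carrier a) → (Fin m → Carrier) → Set ℓ
  Vanishing a b ys c = ∀ k → moment a b ys k c ≈ 0#

  vanishing-drop : ∀ a b (ys : Fin m → Vec Carrier (suc a)) c → Vanishing (suc a) b ys c →
      Vanishing a b (tail ∘ ys) c
  vanishing-drop zero    zero    ys c h = h
  vanishing-drop (suc a) zero    ys c h = h
  vanishing-drop a       (suc b) ys c h k with h (k ↑ˡ _)
  ... | hk rewrite splitAt-↑ˡ (#monomials a (suc b)) k (#monomials (suc a) b) = hk

  vanishing-var : ∀ a b (ys : Fin m → Vec Carrier (suc a)) c → Vanishing (suc a) (suc b) ys c →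
    Vanishing (suc a) b ys (λ i → head (ys i) * c i)
  vanishing-var a b ys c h k with h (#monomials a (suc b) ↑ʳ k)
  ... | hk rewrite splitAt-↑ʳ (#monomials a (suc b)) (#monomials (suc a) b) k = hk

  vanishing-sum : ∀ a b (ys : Fin m → Vec Carrier a) c → Vanishing a b ys c → sum c ≈ 0#
  vanishing-sum zero    b ys c h = h zero
  vanishing-sum (suc a) b ys c h = vanishing-sum a b (tail ∘ ys) c (vanishing-drop a b ys c h)

  -- Induction on the construction of the polynomial: dropping a variable selects some of the
  -- moments, and multiplying by the first variable moves that factor into the weights. No
  -- coefficients have to be extracted.
  vanishing-polynomial : Polynomial a b f → ∀ (ys : Fin m → Vec Carrier a) c → Vanishing a b ys c →
    sum (λ i → f (ys i) * c i) ≈ 0#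
  vanishing-polynomial {a} {b} (const t) ys c h =
    trans (homogeneous sum-linear t c) (trans (*-congˡ (vanishing-sum a b ys c h)) (zeroʳ t))
  vanishing-polynomial {suc a} {b} (drop p) ys c h =
      vanishing-polynomial p (tail ∘ ys) c (vanishing-drop a b ys c h)
  vanishing-polynomial {suc a} {suc b} (var {f = f} p) ys c h = trans
    (sum-cong-≋ (λ i → solve 3 (λ h f c → h :* f :* c := f :* (h :* c)) refl (head (ys i)) (f (ys i)) (c i)))
    (vanishing-polynomial p ys (λ i → head (ys i) * c i) (vanishing-var a b ys c h))
  vanishing-polynomial (add {f = f} {g = g} p q) ys c h = trans
    (sum-cong-≋ (λ i → distribʳ (c i) _ _))
    (trans (∑-distrib-+ (λ i → f (ys i) * c i) (λ i → g (ys i) * c i))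
      (trans (+-cong (vanishing-polynomial p ys c h) (vanishing-polynomial q ys c h)) (+-identityˡ 0#)))
  vanishing-polynomial (scale {f = f} t p) ys c h = trans (sum-cong-≋ (λ i → *-assoc t _ (c i)))
    (trans (homogeneous sum-linear t (λ i → f (ys i) * c i))
      (trans (*-congˡ (vanishing-polynomial p ys c h)) (zeroʳ t)))
  vanishing-polynomial (resp e p) ys c h = trans
    (sum-cong-≋ (λ i → *-congʳ (sym (e (ys i))))) (vanishing-polynomial p ys c h)

  sum-zero : (u : Fin m → Carrier) → (∀ i → u i ≈ 0#) → sum u ≈ 0#
  sum-zero u h = zero-vector sum-linear h

  sum-single : (u : Fin m → Carrier) (i : Fin m) → (∀ k → ¬ k ≡ i → u k ≈ 0#) → sum u ≈ u i
  sum-single {suc m} u i h = trans (sum-remove {i = i} u)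
    (trans (+-congˡ (sum-zero _ (λ k → h (punchIn i k) (punchInᵢ≢i i k)))) (+-identityʳ _))

  -- The rank bound from triangularity.

  -- The matrix with entries ∏_{x ∈ B i} ∏_{z ∈ A k} (x − z) is triangular with respect
  -- to _⊏_, and row i is a polynomial of degree at most b in the a coefficients of
  -- ∏_{z ∈ A k} (t − z).  So there are at most as many rows outside excluded as there
  -- are monomials.
  module _ {r} {m a b : ℕ} {_⊏_ : Rel (Fin m) r}
    (isStrictPartialOrder : IsStrictPartialOrder _≡_ _⊏_)
    (connex : ∀ {i j} → ¬ i ≡ j → ¬ ¬ (i ⊏ j ⊎ j ⊏ i))
    (A B : Fin m → List Carrier) (excluded : List (Fin m))
    (sizes : ∀ i → i ∈ excluded ⊎ (length (A i) ℕ.≤ a × length (B i) ℕ.≤ b))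
    (disjoint : ∀ i → All (λ x → x # 0# × All (x #_) (A i)) (B i))
    (crossing : ∀ {i j} → i ⊏ j → ¬ ¬ ∃ λ z → z ∈ A j × z ∈ B i)
    where

    private
      points : Fin m → Vec Carrier a
      points i = from-roots a (A i)

      functional : Fin (#monomials a b) ⊎ Fin m → (Fin m → Carrier) → Carrier
      functional (inj₁ k) = moment a b points k
      functional (inj₂ i) = λ c → c i

      functional-linear : ∀ k → Linear (functional k)
      functional-linear (inj₁ k) = moment-linear a b points k
      functional-linear (inj₂ i) = coordinate-linear i

      constraints : List (Fin (#monomials a b) ⊎ Fin m)
      constraints = map inj₁ (allFin (#monomials a b)) ++ map inj₂ excluded

      module _ (c : Fin m → Carrier) (vanishing : All (λ k → functional k c ≈ 0#) constraints) where

        excluded⇒0 : ∀ {i} → i ∈ excluded → c i ≈ 0#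
        excluded⇒0 i∈ = All.lookup vanishing (∈-++⁺ʳ _ (∈-map⁺ inj₂ i∈))

        ∏-vanishing : ∀ i → length (B i) ℕ.≤ b → sum (λ k → ∏monic (B i) (points k) * c k) ≈ 0#
        ∏-vanishing i h = vanishing-polynomial (∏monic-polynomial (B i) h) points c
          (λ k → All.lookup vanishing (∈-++⁺ˡ (∈-map⁺ inj₁ (∈-allFin k))))

        -- A strict order on a finite set is well-founded, so back-substitution is possible. In the
        -- relation of row i, terms with k ⊏ i vanish by induction and terms with i ⊏ k because of a
        -- common element; the diagonal factor is apart from zero.
        zero-rec : ∀ i → Acc _⊏_ i → c i ≈ 0#
        zero-rec i (acc below) with sizes i
        ... | inj₁ i∈ = excluded⇒0 i∈
        ... | inj₂ (_ , |Bi|≤b) = *-cancelʳ-0 (∏monic-#0 (All.map (λ (x#0 , x#A) →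
            from-roots-#0 a x#0 x#A) (disjoint i)))
          (trans (*-comm _ _) (trans (sym (sum-single _ i others)) (∏-vanishing i |Bi|≤b)))
          where
          others : ∀ k → ¬ k ≡ i → ∏monic (B i) (points k) * c k ≈ 0#
          others k k≢i = ≈-stable (connex k≢i >>= λ where
            (inj₁ k⊏i) → return (trans (*-congˡ (zero-rec k (below k⊏i))) (zeroʳ _))
            (inj₂ i⊏k) → crossing i⊏k >>= λ (z , z∈A , z∈B) → case-sizes z∈A z∈B (sizes k))
            where
            case-sizes : ∀ {z} → z ∈ A k → z ∈ B i → k ∈ excluded ⊎ (length (A k) ℕ.≤ a × length (B k) ℕ.≤ b) →
              ¬ ¬ (∏monic (B i) (points k) * c k ≈ 0#)
            -- For an excluded `k` the list `A k` may be too long, and `from-roots` may have dropped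
            -- the common element; here the weight is zero instead.
            case-sizes z∈A z∈B (inj₁ k∈) = return (trans (*-congˡ (excluded⇒0 k∈)) (zeroʳ _))
            case-sizes z∈A z∈B (inj₂ (|Ak|≤a , _)) =
              return (trans (*-congʳ (∏monic-≈0 {y = points k} z∈B (from-roots-≈0 |Ak|≤a z∈A))) (zeroˡ _))

    -- No nonzero weight vector satisfies all constraints, so some m of them span the dual of the
    -- m-dimensional space of weights. Excluded indices enter as constraints c i = 0, which avoids
    -- reindexing a subfamily.
    skew-bollobás : m ℕ.≤ #monomials a b ℕ.+ length excluded
    skew-bollobás = decidable-stable (_ ℕ.≤? _)
      (annihilated-or-spans m functional functional-linear constraints >>= λ where
        (inj₁ (c , c≉0 , vanishing)) → ⊥-elim (c≉0 (λ i →
            zero-rec c vanishing i (spo-wellFounded isStrictPartialOrder i)))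
        (inj₂ (bs , cs , xs↭ , |bs|≡m , _)) → return (begin
          m                                        ≡⟨ |bs|≡m ⟨
          length bs                                ≤⟨ ℕ.m≤m+n _ _ ⟩
          length bs ℕ.+ length cs                  ≡⟨ length-++ bs ⟨
          length (bs ++ cs)                        ≡⟨ ↭.↭-length xs↭ ⟨
          length constraints                       ≡⟨ length-++ (map inj₁ (allFin (#monomials a b))) ⟩
          length (map inj₁ (allFin (#monomials a b))) ℕ.+ length (map inj₂ excluded)
            ≡⟨ ≡.cong₂ ℕ._+_ (≡.trans (length-map inj₁ (allFin (#monomials a b))) (length-tabulate _))
                (length-map inj₂ excluded) ⟩
          #monomials a b ℕ.+ length excluded       ∎))
      where open ℕ.≤-Reasoning

  -- Faces of the polytope of polystochastic matrices

  open IsPolystochastic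
  open IsVertex

  ZeroLineSums : Matrix ℝ n d → Set ℓ
  ZeroLineSums {n} {d} x = ∀ (i : Fin d) (α : Vec (Fin n) d) → sum (λ k → x (α [ i ]≔ k)) ≈ 0#

  -- Enumeration and labelling of the matrix indices.

  decode : Fin (n ℕ.^ d) → Vec (Fin n) d
  decode {d = zero}  _ = []
  decode {n} {suc d} j = let (k , j′) = remQuot (n ℕ.^ d) j in k ∷ decode j′

  encode : Vec (Fin n) d → Fin (n ℕ.^ d)
  encode []      = zero
  encode (k ∷ α) = combine k (encode α)

  decode-encode : (α : Vec (Fin n) d) → decode (encode α) ≡ α
  decode-encode []      = ≡.refl
  decode-encode (k ∷ α) = ≡.trans (≡.cong (λ (k , j) → k ∷ decode j) (remQuot-combine k (encode α)))
                                  (≡.cong (k ∷_) (decode-encode α))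

  indices : ∀ n d → List (Vec (Fin n) d)
  indices n d = map decode (allFin (n ℕ.^ d))

  length-indices : ∀ n d → length (indices n d) ≡ n ℕ.^ d
  length-indices n d = ≡.trans (length-map (decode {n} {d}) (allFin (n ℕ.^ d)))
    (length-tabulate {n = n ℕ.^ d} (λ i → i))

  ∈-indices : (α : Vec (Fin n) d) → α ∈ indices n d
  ∈-indices α = ≡.subst (_∈ _) (decode-encode α) (∈-map⁺ decode (∈-allFin (encode α)))

  -- Labels start at 1, because 0# serves as the dummy root in from-roots.
  label : Vec (Fin n) d → Carrier
  label α = suc (toℕ (encode α)) · 1#

  label-#0 : (α : Vec (Fin n) d) → label α # 0#
  label-#0 α = inj₂ (·1-pos (toℕ (encode α)))

  label-# : {α β : Vec (Fin n) d} → ¬ α ≡ β → label α # label β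
  label-# {α = α} {β} α≢β = ·1-apart (λ eq → α≢β (≡.trans (≡.sym (decode-encode α))
    (≡.trans (≡.cong decode (toℕ-injective (ℕ.suc-injective eq))) (decode-encode β))))

  -- Coordinates on the space of matrices with zero line sums.

  slice : ∀ m d → (Fin (m ℕ.^ suc d) → Carrier) → Fin m → Fin (m ℕ.^ d) → Carrier
  slice m d y k j = y (combine k j)

  -- A matrix with zero line sums is determined by its entries at indices without the
  -- coordinate zero, and these are arbitrary.
  extend : (Fin (m ℕ.^ d) → Carrier) → Matrix ℝ (suc m) d
  extend {m} {zero}  y []          = y zero
  extend {m} {suc d} y (suc k ∷ α) = extend (slice m d y k) α
  extend {m} {suc d} y (zero ∷ α)  = - sum (λ k → extend (slice m d y k) α)

  extend-linear : (α : Vec (Fin (suc m)) d) → Linear (λ y → extend {m} {d} y α)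
  extend-linear-slice : ∀ (k : Fin m) (α : Vec (Fin (suc m)) d) →
    Linear (λ y → extend {m} {d} (slice m d y k) α)

  extend-linear {m} {zero}  []          = coordinate-linear zero
  extend-linear {m} {suc d} (suc k ∷ α) = extend-linear-slice k α
  extend-linear {m} {suc d} (zero ∷ α)  = record
    { cong        = λ h → -‿cong (cong lin h)
    ; additive    = λ u v → trans (-‿cong (additive lin u v)) (-‿+ _ _)
    ; homogeneous = λ t u → trans (-‿cong (homogeneous lin t u)) (-‿distribʳ-* t _)
    }
    where
    lin : Linear (λ y → sum (λ k → extend {m} {d} (slice m d y k) α))
    lin = ∘-linear sum-linear (λ k → extend-linear-slice k α)

  extend-linear-slice k α = ∘-linear (extend-linear α) (λ j → coordinate-linear (combine k j))

  restrict : Matrix ℝ (suc m) d → Fin (m ℕ.^ d) → Carrier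
  restrict {m} {zero}  x _ = x []
  restrict {m} {suc d} x j = let (k , j′) = remQuot (m ℕ.^ d) j in restrict (λ α → x (suc k ∷ α)) j′

  head-line : (x : Matrix ℝ (suc m) (suc d)) → ZeroLineSums x → ∀ α → x (zero ∷ α) ≈ - sum (λ k → x (suc k ∷ α))
  head-line x h α = x-y≈0⇒x≈y (trans (+-congˡ (-‿involutive _)) (h zero (zero ∷ α)))

  -- The lines in the first direction force the slice at `zero`; the other slices again have zero
  -- line sums, so induction on d recovers them.
  extend-restrict : (x : Matrix ℝ (suc m) d) → ZeroLineSums x → ∀ α → extend (restrict x) α ≈ x α
  extend-restrict-slice : (x : Matrix ℝ (suc m) (suc d)) → ZeroLineSums x → ∀ k α →
    extend (slice m d (restrict x) k) α ≈ x (suc k ∷ α)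

  extend-restrict {m} {zero}  x h []          = refl
  extend-restrict {m} {suc d} x h (suc k ∷ α) = extend-restrict-slice x h k α
  extend-restrict {m} {suc d} x h (zero ∷ α)  = trans
    (-‿cong (sum-cong-≋ (λ k → extend-restrict-slice x h k α)))
    (sym (head-line x h α))

  extend-restrict-slice x h k α = trans
    (cong (extend-linear α) (λ j → reflexive
      (≡.cong (λ (k , j) → restrict (λ α → x (suc k ∷ α)) j) (remQuot-combine k j))))
    (extend-restrict (λ α → x (suc k ∷ α)) (λ i α → h (suc i) (suc k ∷ α)) α)

  sum-neg : (u : Fin n → Carrier) → sum (λ l → - u l) ≈ - sum u
  sum-neg {zero}  u = sym -0#≈0#
  sum-neg {suc n} u = trans (+-congˡ (sum-neg (u ∘ suc))) (sym (-‿+ _ _))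

  extend-zeroLineSums : (y : Fin (m ℕ.^ d) → Carrier) → ZeroLineSums {suc m} {d} (extend y)
  extend-zeroLineSums {m} {suc d} y zero    (_ ∷ α)     = -‿inverseˡ _
  extend-zeroLineSums {m} {suc d} y (suc i) (suc k ∷ α) = extend-zeroLineSums {m} {d} (slice m d y k) i α
  -- The slice at `zero` is minus the sum of the other slices, so exchanging the two sums reduces
  -- its lines to theirs.
  extend-zeroLineSums {m} {suc d} y (suc i) (zero ∷ α)  = begin
    sum (λ l → - sum (λ k → x k l))  ≈⟨ sum-neg (λ l → sum (λ k → x k l)) ⟩
    - sum (λ l → sum (λ k → x k l))  ≈⟨ -‿cong (∑-comm (λ l k → x k l)) ⟩
    - sum (λ k → sum (λ l → x k l))
      ≈⟨ -‿cong (sum-zero _ (λ k → extend-zeroLineSums {m} {d} (slice m d y k) i α)) ⟩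
    - 0#                             ≈⟨ -0#≈0# ⟩
    0#                               ∎
    where
    open ≈-Reasoning
    x : Fin m → Fin (suc m) → Carrier
    x k l = extend (slice m d y k) (α [ i ]≔ l)

  extend-injective : (y : Fin (m ℕ.^ d) → Carrier) → (∀ α → extend {m} {d} y α ≈ 0#) → ∀ j → y j ≈ 0#
  extend-injective {m} {zero}  y h zero = h []
  extend-injective {m} {suc d} y h j = ≡.subst (λ i → y i ≈ 0#) (combine-remQuot {m} (m ℕ.^ d) j)
    (let (k , j′) = remQuot {m} (m ℕ.^ d) j in
     extend-injective {m} {d} (slice m d y k) (λ α → h (suc k ∷ α)) j′)

  -- Rearrangement and signs of linear combinations.

  combination-++ : {B : Set} (ps qs : List (Carrier × B)) (h : B → Carrier) →
    combination (ps ++ qs) h ≈ combination ps h + combination qs h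
  combination-++ []             qs h = sym (+-identityˡ _)
  combination-++ ((t , b) ∷ ps) qs h = trans (+-congˡ (combination-++ ps qs h)) (sym (+-assoc _ _ _))

  combination-↭ : {B : Set} {ps qs : List (Carrier × B)} → ps ↭ qs → (h : B → Carrier) →
      combination ps h ≈ combination qs h
  combination-↭ Perm.refl h = refl
  combination-↭ (Perm.prep _ p) h = +-congˡ (combination-↭ p h)
  combination-↭ (Perm.swap (s , a) (t , b) p) h = trans (+-congˡ (+-congˡ (combination-↭ p h)))
    (solve 3 (λ x y z → x :+ (y :+ z) := y :+ (x :+ z)) refl (s * h a) (t * h b) _)
  combination-↭ (Perm.trans p q) h = trans (combination-↭ p h) (combination-↭ q h)

  combination-nonNeg : {B : Set} {ps : List (Carrier × B)} {h : B → Carrier} →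
    All (λ p → 0# ≤ proj₁ p) ps → (∀ b → 0# ≤ h b) → 0# ≤ combination ps h
  combination-nonNeg []           0≤h = ≈⇒≤ refl
  combination-nonNeg (0≤t ∷ 0≤ts) 0≤h = +-nonNeg (*-nonNeg 0≤t (0≤h _)) (combination-nonNeg 0≤ts 0≤h)

  combination-nonPos : {B : Set} {ps : List (Carrier × B)} {h : B → Carrier} →
    All (λ p → proj₁ p < 0#) ps → (∀ b → 0# ≤ h b) → 0# ≤ - combination ps h
  combination-nonPos []           0≤h = ≈⇒≤ (sym -0#≈0#)
  combination-nonPos (t<0 ∷ ts<0) 0≤h = ≤-resp refl
    (trans (+-congʳ (sym (-‿distribˡ-* _ _))) (sym (-‿+ _ _)))
    (+-nonNeg (*-nonNeg (<⇒≤ (x<0⇒0<-x t<0)) (0≤h _)) (combination-nonPos ts<0 0≤h))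

  combination-cong-on : {B : Set} {ps : List (Carrier × B)} {h k : B → Carrier} →
    All (λ p → h (proj₂ p) ≈ k (proj₂ p)) ps → combination ps h ≈ combination ps k
  combination-cong-on []       = refl
  combination-cong-on (e ∷ es) = +-cong (*-congˡ e) (combination-cong-on es)

  combination-0 : {B : Set} {ps : List (Carrier × B)} {h : B → Carrier} →
    All (λ p → h (proj₂ p) ≈ 0#) ps → combination ps h ≈ 0#
  combination-0 []       = refl
  combination-0 (e ∷ es) = trans (+-cong (trans (*-congˡ e) (zeroʳ _)) (combination-0 es)) (+-identityˡ 0#)

  -- Rigidity of vertices.

  positive-eventually-dominates : ∀ {v} → 0# < v → ∀ x → Eventually (λ t → 0# ≤ t · 1# * v + x)
  positive-eventually-dominates {v} 0<v x =
    -- The natural number `k` exceeds -x / v, and t v + x = (t + x / v) v.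
    let (w , vw≈1) = inverse (inj₂ 0<v)
        (k , -xw<k) = archimedean (- (x * w))
    in k , λ t k≤t → ≤-resp refl
      (trans (solve 4 (λ t x w v → (t :- (:- (x :* w))) :* v := t :* v :+ x :* (v :* w)) refl (t · 1#) x w v)
               (+-congˡ (trans (*-congˡ vw≈1) (*-identityʳ x))))
      (*-nonNeg (<⇒≤ (x<y⇒0<y-x (bound k≤t -xw<k))) (<⇒≤ 0<v))
    where
    bound : ∀ {z k t} → k ℕ.≤ t → z < k · 1# → z < t · 1#
    bound k≤t z<k with ℕ.m≤n⇒m<n∨m≡n k≤t
    ... | inj₁ k<t    = <-trans z<k (·1-mono k<t)
    ... | inj₂ ≡.refl = z<k

  half : ∃ λ h → 0# < h × h < 1# × h + h ≈ 1#
  half =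
    let 0<2 = +-pos 0<1 0<1
        (h , 2h≈1) = inverse (inj₂ 0<2)
        0<h = inverse-pos 0<2 2h≈1
        h+h≈1 = trans (sym (trans (distribʳ h 1# 1#) (+-cong (*-identityˡ h) (*-identityˡ h)))) 2h≈1
    in h , 0<h
     , <-respˡ-≈ (+-identityˡ h) (<-respʳ-≈ h+h≈1 (+-monoˡ-< h 0<h))
     , h+h≈1

  module _ {v : Matrix ℝ n d} (vertex : IsVertex ℝ v) where

    private module P = IsPolystochastic (isPolystochastic vertex)

    -- Here r = 1 / t. Nonnegativity is assumed in the form scaled by t because this is what the
    -- Archimedean property delivers.
    perturbed-polystochastic : {x : Matrix ℝ n d} → ZeroLineSums x → ∀ t r → 0# < r → r * t ≈ 1# →
      (∀ α → 0# ≤ t * v α + x α) → IsPolystochastic ℝ (λ α → v α + r * x α)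
    perturbed-polystochastic {x} lines t r 0<r rt≈1 0≤ = record
      { nonNegative = λ α → ≤-resp refl
          (trans (solve 4 (λ r t v x → r :* (t :* v :+ x) := (r :* t) :* v :+ r :* x) refl r t (v α) (x α))
                   (+-congʳ (trans (*-congʳ rt≈1) (*-identityˡ _))))
          (*-nonNeg (<⇒≤ 0<r) (0≤ α))
      ; lineSum = λ i α → trans (∑-distrib-+ (λ k → v (α [ i ]≔ k)) (λ k → r * x (α [ i ]≔ k)))
          (trans (+-cong (P.lineSum i α)
            (trans (homogeneous sum-linear r (λ k → x (α [ i ]≔ k))) (trans (*-congˡ (lines i α)) (zeroʳ r))))
                 (+-identityʳ 1#))
      }

    -- v ± x / t is polystochastic for large t, so extremality forces x = 0.
    vertex-rigid : {x : Matrix ℝ n d} → ZeroLineSums x → (∀ α → v α ≈ 0# → x α ≈ 0#) → ∀ α → x α ≈ 0#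
    vertex-rigid {x} lines supported α = ≈-stable (
      ¬¬-all {xs = indices n d} (All.universal dominated (indices n d)) >>= λ evs →
      let (k , ev) = eventually-all evs
          -- The multiplier is `suc k` rather than `k` in order to be positive, hence invertible.
          bounds : ∀ β → 0# ≤ suc k · 1# * v β + x β × 0# ≤ suc k · 1# * v β + - 1# * x β
          bounds β = All.lookup (ev (suc k) (ℕ.n≤1+n k)) (∈-indices β)
          0<t = ·1-pos k
          (r , tr≈1) = inverse (inj₂ 0<t)
          0<r = inverse-pos 0<t tr≈1
          rt≈1 = trans (*-comm r _) tr≈1
          (h , 0<h , h<1 , h+h≈1) = half
          (B≋v , _) = extreme vertex _ _ h
            (perturbed-polystochastic lines _ r 0<r rt≈1 (λ β → proj₁ (bounds β)))
            (perturbed-polystochastic {x = λ β → - 1# * x β}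
              (λ i β → trans (homogeneous sum-linear (- 1#) (λ k → x (β [ i ]≔ k)))
                (trans (*-congˡ (lines i β)) (zeroʳ _)))
              _ r 0<r rt≈1 (λ β → proj₂ (bounds β)))
            0<h h<1 (λ β → midpoint h h+h≈1 (v β) (r * x β) (r * (- 1# * x β))
              (solve 2 (λ r x → r :* (:- con (1 , 0) :* x) := :- (r :* x)) refl r (x β)))
      in return (*-cancelʳ-0 (inj₂ 0<r) (trans (*-comm _ _) (cancel (B≋v α)))))
      where
      dominated : ∀ β → ¬ ¬ Eventually (λ t → 0# ≤ t · 1# * v β + x β × 0# ≤ t · 1# * v β + - 1# * x β)
      -- A positive entry of v outweighs both signs of x for large t; at a zero of v the
      -- perturbation vanishes by hypothesis.
      dominated β = 0≤⇒¬¬ (P.nonNegative β) >>= λ where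
        (inj₁ 0<vβ) → let (k , p) = positive-eventually-dominates 0<vβ (x β)
                          (k′ , q) = positive-eventually-dominates 0<vβ (- 1# * x β)
          in return (k ℕ.⊔ k′ , λ t h → p t (ℕ.≤-trans (ℕ.m≤m⊔n k k′) h) , q t (ℕ.≤-trans (ℕ.m≤n⊔m k k′) h))
        (inj₂ vβ≈0) → let xβ≈0 = supported β vβ≈0 in return (0 , λ t _ →
            ≈⇒≤ (sym (trans (+-cong (trans (*-congˡ vβ≈0) (zeroʳ _)) xβ≈0) (+-identityˡ 0#)))
          , ≈⇒≤ (sym (trans (+-cong (trans (*-congˡ vβ≈0) (zeroʳ _)) (trans (*-congˡ xβ≈0) (zeroʳ _)))
              (+-identityˡ 0#))))
      midpoint : ∀ h → h + h ≈ 1# → ∀ a p q → q ≈ - p → a ≈ h * (a + p) + (1# - h) * (a + q)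
      midpoint h h+h≈1 a p q q≈-p = begin
        a                                          ≈⟨ *-identityʳ a ⟨
        a * 1#                                     ≈⟨ *-congˡ h+h≈1 ⟨
        a * (h + h)
          ≈⟨ solve 3 (λ a h p → a :* (h :+ h) := h :* (a :+ p) :+ ((h :+ h) :- h) :* (a :+ :- p)) refl a h p ⟩
        h * (a + p) + ((h + h) - h) * (a + - p)
          ≈⟨ +-congˡ (*-cong (+-congʳ h+h≈1) (+-congˡ (sym q≈-p))) ⟩
        h * (a + p) + (1# - h) * (a + q)           ∎
        where open ≈-Reasoning
      cancel : ∀ {a p} → a + p ≈ a → p ≈ 0#
      cancel {a} {p} h = trans (solve 2 (λ a p → p := (a :+ p) :- a) refl a p) (x≈y⇒x-y≈0 h)

  -- Optimality certificates for vertices.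

  difference-zeroLineSums : {x v : Matrix ℝ n d} → IsPolystochastic ℝ x → IsPolystochastic ℝ v →
      ZeroLineSums (λ α → x α + - 1# * v α)
  difference-zeroLineSums {x = x} {v} px pv i α = trans
    (additive sum-linear (λ k → x (α [ i ]≔ k)) (λ k → - 1# * v (α [ i ]≔ k)))
    (trans (+-cong (lineSum px i α)
        (trans (homogeneous sum-linear (- 1#) (λ k → v (α [ i ]≔ k))) (*-congˡ (lineSum pv i α))))
           (solve 0 (con (1 , 0) :+ :- con (1 , 0) :* con (1 , 0) := con (0 , 0)) refl))

  linear-difference : {X : Set} {φ : (X → Carrier) → Carrier} → Linear φ → ∀ x v →
    φ (λ i → x i + - 1# * v i) ≈ φ x - φ v
  linear-difference {φ = φ} lφ x v = trans (additive lφ x (λ i → - 1# * v i)) (+-congˡ (trans (homogeneous lφ (- 1#) v)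
    (solve 1 (λ a → :- con (1 , 0) :* a := :- a) refl (φ v))))

  -- Keeps what the counting needs from the expansion of φ at v: the zeros split by sign, their
  -- number and the two extremal properties. The coefficients themselves are forgotten.
  record Certificate {m d} (φ : Matrix ℝ (suc m) d → Carrier) (v : Matrix ℝ (suc m) d) : Set (c ⊔ ℓ) where
    field
      lower upper support : List (Vec (Fin (suc m)) d)
      length-lower+upper : length lower ℕ.+ length upper ≡ m ℕ.^ d
      length-support     : length support ℕ.≤ suc m ℕ.^ d ℕ.∸ m ℕ.^ d
      zero-on-lower      : All (λ α → v α ≈ 0#) lower
      zero-on-upper      : All (λ α → v α ≈ 0#) upper
      nonzero-on-support : All (λ α → v α # 0#) support
      support-complete   : ∀ α → v α # 0# → α ∈ support
      minimal : ∀ {x} → IsPolystochastic ℝ x → All (λ α → x α ≈ 0#) lower → φ v ≤ φ x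
      maximal : ∀ {x} → IsPolystochastic ℝ x → All (λ α → x α ≈ 0#) upper → φ x ≤ φ v

  module _ {m d} {φ : Matrix ℝ (suc m) d → Carrier} (lφ : Linear φ) {v : Matrix ℝ (suc m) d}
      (vertex : IsVertex ℝ v) where

    module _ {ps : List (Carrier × Vec (Fin (suc m)) d)} (ps≈0 : All (λ p → v (proj₂ p) ≈ 0#) ps)
      (expansion : ∀ y → φ (extend y) ≈ combination ps (extend y)) where

      -- The difference x - v has zero line sums, so the expansion of φ applies to it; at the
      -- indices that occur v is zero, and only x remains.
      objective-gap : ∀ {x} → IsPolystochastic ℝ x → φ x - φ v ≈ combination ps x
      objective-gap {x} px = begin
        φ x - φ v                        ≈⟨ linear-difference lφ x v ⟨
        φ δ                              ≈⟨ cong lφ (extend-restrict δ lines) ⟨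
        φ (extend (restrict δ))          ≈⟨ expansion (restrict δ) ⟩
        combination ps (extend (restrict δ)) ≈⟨ combination-cong ps (extend-restrict δ lines) ⟩
        combination ps δ
          ≈⟨ combination-cong-on (All.map
              (λ e → trans (+-congˡ (trans (*-congˡ e) (zeroʳ _))) (+-identityʳ _)) ps≈0) ⟩
        combination ps x                 ∎
        where
        open ≈-Reasoning
        δ : Matrix ℝ (suc m) d
        δ α = x α + - 1# * v α
        lines : ZeroLineSums δ
        lines = difference-zeroLineSums px (isPolystochastic vertex)

    certificate : ¬ ¬ Certificate φ v
    certificate =
      ¬¬-partition (λ α → #⊎≈ (v α) 0#) (indices (suc m) d) >>= λ (S , T , I↭S++T , S#0 , T≈0) →
      annihilated-or-spans (m ℕ.^ d) (λ α y → extend y α) extend-linear T >>= λ where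
        (inj₁ (y , y≉0 , T-annihilated)) →
          -- The annihilated vector would extend to a matrix with zero line sums that vanishes
          -- wherever v does; rigidity makes it zero.
          let on-T : ∀ α → v α ≈ 0# → extend y α ≈ 0#
              on-T α vα≈0 = All.lookup T-annihilated (in-T I↭S++T S#0 α vα≈0)
          in ⊥-elim (y≉0 (extend-injective y (vertex-rigid vertex (extend-zeroLineSums y) on-T)))
        (inj₂ (bs , cs , T↭bs++cs , |bs|≡D , spans)) →
          let (ps , ps≡bs , expansion) = spans (φ ∘ extend) (∘-linear lφ extend-linear)
              ps≈0 = All.map⁻ (≡.subst (All _) (≡.sym ps≡bs) (All.++⁻ˡ bs (↭.All-resp-↭ T↭bs++cs T≈0)))
          in ¬¬-partition {P = λ p → proj₁ p < 0#} {Q = λ p → 0# ≤ proj₁ p}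
              -- As `0# ≤ t` is by definition the negation of `t < 0#`, this is the double negation
              -- of excluded middle.
              (λ p k → k (inj₂ (λ p<0 → k (inj₁ p<0)))) ps
            >>= λ (neg , pos , ps↭ , neg<0 , 0≤pos) →
          let split : ∀ x → combination ps x ≈ combination neg x + combination pos x
              split x = trans (combination-↭ ps↭ x) (combination-++ neg pos x)
              signed≈0 = ↭.All-resp-↭ ps↭ ps≈0
          in return record
            { lower = map proj₂ neg
            ; upper = map proj₂ pos
            ; support = S
            ; length-lower+upper = ≡.trans (≡.cong₂ ℕ._+_ (length-map proj₂ neg) (length-map proj₂ pos))
                (≡.trans (≡.sym (length-++ neg)) (≡.trans (≡.sym (↭.↭-length ps↭))
                (≡.trans (≡.sym (length-map proj₂ ps)) (≡.trans (≡.cong length ps≡bs) |bs|≡D))))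
            ; length-support = support-bound S T bs cs I↭S++T T↭bs++cs |bs|≡D
            ; zero-on-lower = All.map⁺ (All.++⁻ˡ neg signed≈0)
            ; zero-on-upper = All.map⁺ (All.++⁻ʳ neg signed≈0)
            ; nonzero-on-support = S#0
            ; support-complete = in-S I↭S++T T≈0
            -- Where x vanishes on `lower`, the gap φ x - φ v retains only nonnegative coefficients;
            -- for `maximal` it retains only the negative ones.
            ; minimal = λ {x} px x≈0 → gap⇒≤ (≤-resp refl
                (sym (trans (objective-gap ps≈0 expansion px) (trans (split x)
                  (trans (+-congʳ (combination-0 (All.map⁻ x≈0))) (+-identityˡ _)))))
                (combination-nonNeg 0≤pos (nonNegative px)))
            ; maximal = λ {x} px x≈0 → gap⇒≤ (≤-resp refl
                (trans (-‿cong (sym (trans (objective-gap ps≈0 expansion px) (trans (split x)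
                  (trans (+-congˡ (combination-0 (All.map⁻ x≈0))) (+-identityʳ _))))))
                  (solve 2 (λ a b → :- (a :- b) := b :- a) refl (φ x) (φ v)))
                (combination-nonPos neg<0 (nonNegative px)))
            }
      where
      gap⇒≤ : ∀ {a b} → 0# ≤ b - a → a ≤ b
      gap⇒≤ 0≤b-a b<a = 0≤b-a (<-respʳ-≈ (-‿inverseʳ _) (+-monoˡ-< _ b<a))

      located : ∀ {S T} → indices (suc m) d ↭ S ++ T → ∀ α → α ∈ S ⊎ α ∈ T
      located {S} p α = ∈-++⁻ S (↭.∈-resp-↭ p (∈-indices α))

      in-T : ∀ {S T} → indices (suc m) d ↭ S ++ T → All (λ α → v α # 0#) S → ∀ α → v α ≈ 0# → α ∈ T
      in-T p S#0 α vα≈0 with located p α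
      ... | inj₁ α∈S = ⊥-elim (≈⇒¬# vα≈0 (All.lookup S#0 α∈S))
      ... | inj₂ α∈T = α∈T

      in-S : ∀ {S T} → indices (suc m) d ↭ S ++ T → All (λ α → v α ≈ 0#) T → ∀ α → v α # 0# → α ∈ S
      in-S p T≈0 α vα#0 with located p α
      ... | inj₁ α∈S = α∈S
      ... | inj₂ α∈T = ⊥-elim (≈⇒¬# (All.lookup T≈0 α∈T) vα#0)

      -- The support and the D spanning zeros occupy disjoint parts of the enumeration of all
      -- indices.
      support-bound : ∀ S T bs cs → indices (suc m) d ↭ S ++ T → T ↭ bs ++ cs → length bs ≡ m ℕ.^ d →
        length S ℕ.≤ suc m ℕ.^ d ℕ.∸ m ℕ.^ d
      support-bound S T bs cs p q |bs|≡D = ℕ.m+n≤o⇒m≤o∸n (length S) (begin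
        length S ℕ.+ m ℕ.^ d                       ≡⟨ ≡.cong (length S ℕ.+_) |bs|≡D ⟨
        length S ℕ.+ length bs
          ≤⟨ ℕ.+-monoʳ-≤ (length S) (ℕ.m≤m+n (length bs) (length cs)) ⟩
        length S ℕ.+ (length bs ℕ.+ length cs)
          ≡⟨ ≡.cong (length S ℕ.+_) (≡.trans (↭.↭-length q) (length-++ bs)) ⟨
        length S ℕ.+ length T                      ≡⟨ ≡.trans (↭.↭-length p) (length-++ S) ⟨
        length (indices (suc m) d)                 ≡⟨ length-indices (suc m) d ⟩
        suc m ℕ.^ d                                ∎)
        where open ℕ.≤-Reasoning

  -- Counting the vertices.

  length-filter-complement : ∀ {p} {X : Set} {P : X → Set p} (P? : Decidable P) xs →
    length (filter P? xs) ℕ.+ length (filter (¬? ∘ P?) xs) ≡ length xs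
  length-filter-complement P? []       = ≡.refl
  length-filter-complement P? (x ∷ xs) with P? x
  ... | yes _ = ≡.cong suc (length-filter-complement P? xs)
  ... | no  _ = ≡.trans (ℕ.+-suc _ _) (≡.cong suc (length-filter-complement P? xs))

  -- Raising k by two raises each half by one. For k = D this makes the two size thresholds add up
  -- to D - 1.
  halves-sum : ∀ k → (k ℕ.+ 1) ℕ./ 2 ℕ.+ (k ℕ.+ 2) ℕ./ 2 ≡ suc k
  halves-sum zero          = ≡.refl
  halves-sum (suc zero)    = ≡.refl
  halves-sum (suc (suc k)) = ≡.trans (≡.cong₂ ℕ._+_ (step (k ℕ.+ 1)) (step (k ℕ.+ 2)))
    (≡.trans (≡.cong suc (ℕ.+-suc _ _)) (≡.cong (λ j → suc (suc j)) (halves-sum k)))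
    where
    step : ∀ j → (2 ℕ.+ j) ℕ./ 2 ≡ suc (j ℕ./ 2)
    step j = ℕ.+-distrib-/-∣ˡ {2} j {2} ∣-refl

  open CommutativeSemigroupProperties ℕ.+-commutativeSemigroup using () renaming (interchange to ℕ-interchange)

  module _ {m d V : ℕ} (v : Fin V → Matrix ℝ (suc m) d) (vertex : ∀ j → IsVertex ℝ (v j))
    {φ : Matrix ℝ (suc m) d → Carrier} (certificates : ∀ j → Certificate φ (v j))
    (φ-injective : ∀ {i j} → ¬ i ≡ j → φ (v i) # φ (v j)) where

    private
      D N : ℕ
      D = m ℕ.^ d
      N = suc m ℕ.^ d
      module Cert (j : Fin V) = Certificate (certificates j)

      _≺_ : Rel (Fin V) ℓ
      i ≺ j = φ (v i) < φ (v j)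

      ≺-isStrictPartialOrder : IsStrictPartialOrder _≡_ _≺_
      ≺-isStrictPartialOrder = record
        { isEquivalence = ≡.isEquivalence
        ; irrefl        = λ { ≡.refl → <-irrefl refl }
        ; trans         = <-trans
        ; <-resp-≈      = ≡.resp₂ _≺_
        }

      ≻-isStrictPartialOrder : IsStrictPartialOrder _≡_ (flip _≺_)
      ≻-isStrictPartialOrder = record
        { isEquivalence = ≡.isEquivalence
        ; irrefl        = λ { ≡.refl → <-irrefl refl }
        ; trans         = λ p q → <-trans q p
        ; <-resp-≈      = ≡.resp₂ (flip _≺_)
        }

      labels-disjoint : ∀ j (R : List (Vec (Fin (suc m)) d)) → All (λ α → v j α ≈ 0#) R →
        All (λ x → x # 0# × All (x #_) (map label R)) (map label (Cert.support j))
      labels-disjoint j R R≈0 = All.map⁺ (All.map (λ {α} vα#0 → label-#0 α ,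
        All.map⁺ (All.map (λ {β} vβ≈0 → label-# {α = α} {β} (λ { ≡.refl → ≈⇒¬# vβ≈0 vα#0 })) R≈0))
        (Cert.nonzero-on-support j))

      -- By contraposition: if no index of `R` were in the support of `v i`, then `v i` would vanish
      -- on `R`.
      labels-cross : ∀ i (R : List (Vec (Fin (suc m)) d)) → ¬ All (λ α → v i α ≈ 0#) R →
        ¬ ¬ ∃ λ z → z ∈ map label R × z ∈ map label (Cert.support i)
      labels-cross i R ¬R≈0 none = ¬R≈0 (All.tabulate (λ {α} α∈R → ¬#⇒≈ (λ vα#0 →
        none (label α , ∈-map⁺ label α∈R , ∈-map⁺ label (Cert.support-complete i α vα#0)))))

      length-labels : ∀ {k} (R : List (Vec (Fin (suc m)) d)) → length R ℕ.≤ k → length (map label R) ℕ.≤ k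
      length-labels R = ℕ.≤-trans (ℕ.≤-reflexive (length-map label R))

    module _ (a₁ a₂ : ℕ) (D≤ : D ℕ.≤ suc (a₁ ℕ.+ a₂)) where
      private
        Large : Fin V → Set
        Large j = a₁ ℕ.< length (Cert.lower j)

        large? : Decidable Large
        large? j = a₁ ℕ.<? length (Cert.lower j)

        large small : List (Fin V)
        large = filter large? (allFin V)
        small = filter (¬? ∘ large?) (allFin V)

        length-upper : ∀ j → Large j → length (Cert.upper j) ℕ.≤ a₂
        length-upper j a₁<|R| = ℕ.+-cancelˡ-≤ (suc a₁) _ _ (begin
          suc a₁ ℕ.+ length (Cert.upper j)               ≤⟨ ℕ.+-monoˡ-≤ _ a₁<|R| ⟩
          length (Cert.lower j) ℕ.+ length (Cert.upper j)   ≡⟨ Cert.length-lower+upper j ⟩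
          D                                           ≤⟨ D≤ ⟩
          suc a₁ ℕ.+ a₂                               ∎)
          where open ℕ.≤-Reasoning

        -- If φ (v i) < φ (v j), then `v i` is not on the face given by `Cert.lower j`, where `v j`
        -- minimises φ. So that list meets the support of `v i`.
        lower-bound : V ℕ.≤ #monomials a₁ (N ℕ.∸ D) ℕ.+ length large
        lower-bound = skew-bollobás ≺-isStrictPartialOrder φ-connex
          (map label ∘ Cert.lower) (map label ∘ Cert.support) large sizes
          (λ j → labels-disjoint j (Cert.lower j) (Cert.zero-on-lower j))
          (λ {i} {j} i≺j → labels-cross i (Cert.lower j) (λ R≈0 →
              Cert.minimal j (isPolystochastic (vertex i)) R≈0 i≺j))
          where
          φ-connex : ∀ {i j} → ¬ i ≡ j → ¬ ¬ (i ≺ j ⊎ j ≺ i)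
          φ-connex i≢j = return (φ-injective i≢j)
          sizes : ∀ j → j ∈ large ⊎
            (length (map label (Cert.lower j)) ℕ.≤ a₁ × length (map label (Cert.support j)) ℕ.≤ N ℕ.∸ D)
          sizes j with large? j
          ... | yes p = inj₁ (∈-filter⁺ large? (∈-allFin j) p)
          ... | no ¬p = inj₂ (length-labels (Cert.lower j) (ℕ.≮⇒≥ ¬p) ,
              length-labels (Cert.support j) (Cert.length-support j))

        -- The same argument for the reversed order, with `maximal`; the vertices kept here are
        -- those excluded from the other bound, since `length-upper` controls their upper lists.
        upper-bound : V ℕ.≤ #monomials a₂ (N ℕ.∸ D) ℕ.+ length small
        upper-bound = skew-bollobás ≻-isStrictPartialOrder φ-connex
          (map label ∘ Cert.upper) (map label ∘ Cert.support) small sizes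
          (λ j → labels-disjoint j (Cert.upper j) (Cert.zero-on-upper j))
          (λ {i} {j} j≺i → labels-cross i (Cert.upper j) (λ R≈0 →
              Cert.maximal j (isPolystochastic (vertex i)) R≈0 j≺i))
          where
          φ-connex : ∀ {i j} → ¬ i ≡ j → ¬ ¬ (j ≺ i ⊎ i ≺ j)
          φ-connex i≢j = return (swap (φ-injective i≢j))
          sizes : ∀ j → j ∈ small ⊎
            (length (map label (Cert.upper j)) ℕ.≤ a₂ × length (map label (Cert.support j)) ℕ.≤ N ℕ.∸ D)
          sizes j with large? j
          ... | yes p = inj₂ (length-labels (Cert.upper j) (length-upper j p) ,
              length-labels (Cert.support j) (Cert.length-support j))
          ... | no ¬p = inj₁ (∈-filter⁺ (¬? ∘ large?) (∈-allFin j) ¬p)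

      -- Every vertex is excluded in exactly one of the two bounds, so their sum has V on the right
      -- as well as V + V on the left, and one V cancels.
      vertex-count : V ℕ.≤ #monomials a₁ (N ℕ.∸ D) ℕ.+ #monomials a₂ (N ℕ.∸ D)
      vertex-count = ℕ.+-cancelʳ-≤ V _ _ (begin
        V ℕ.+ V                                          ≤⟨ ℕ.+-mono-≤ lower-bound upper-bound ⟩
        (p ℕ.+ length large) ℕ.+ (q ℕ.+ length small)
          ≡⟨ ℕ-interchange p (length large) q (length small) ⟩
        (p ℕ.+ q) ℕ.+ (length large ℕ.+ length small)    ≡⟨ ≡.cong ((p ℕ.+ q) ℕ.+_)
          (≡.trans (length-filter-complement large? (allFin V)) (length-tabulate {n = V} (λ i → i))) ⟩
        (p ℕ.+ q) ℕ.+ V                                  ∎)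
        where
        open ℕ.≤-Reasoning
        p = #monomials a₁ (N ℕ.∸ D)
        q = #monomials a₂ (N ℕ.∸ D)

  -- Separation of the vertices and the final estimate.

  separating-functional : ∀ {n d V} (v : Fin V → Matrix ℝ n d) →
    (∀ {i j} → ¬ i ≡ j → ¬ (∀ α → v i α ≈ v j α)) →
    ¬ ¬ ∃ λ φ → Linear φ × (∀ {i j} → ¬ i ≡ j → φ (v i) # φ (v j))
  separating-functional {n} {d} {V} v distinct = generic-functional (map difference pairs) nonzero >>=
      λ (φ , lφ , φ#0) →
    return (φ , lφ , λ {i} {j} i≢j → x-y#0⇒x#y (#-resp (linear-difference lφ (v i) (v j)) refl
      (All.lookup φ#0 (∈-map⁺ difference (∈-filter⁺ apart?
        (∈-cartesianProduct⁺ (∈-allFin i) (∈-allFin j)) i≢j)))))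
    where
    difference : Fin V × Fin V → Matrix ℝ n d
    difference (i , j) α = v i α + - 1# * v j α
    apart? : Decidable (λ ((i , j) : Fin V × Fin V) → ¬ i ≡ j)
    apart? (i , j) = ¬? (i Fin.≟ j)
    pairs : List (Fin V × Fin V)
    pairs = filter apart? (cartesianProduct (allFin V) (allFin V))
    nonzero : All (λ u → ¬ (∀ α → u α ≈ 0#)) (map difference pairs)
    nonzero = All.map⁺ (All.map (λ {(i , j)} i≢j u≈0 → distinct i≢j (λ α → x-y≈0⇒x≈y
      (trans (solve 2 (λ a b → a :- b := a :+ :- con (1 , 0) :* b) refl (v i α) (v j α)) (u≈0 α))))
      (All.all-filter apart? (cartesianProduct (allFin V) (allFin V))))

  vertex-bound : ∀ m d V → 1 ℕ.≤ m →
    Injection (≡.setoid (Fin V)) (vertexSetoid ℝ (suc m) d) →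
    let N = suc m ℕ.^ d; D = m ℕ.^ d in
    V ℕ.≤ (N ℕ.∸ (D ℕ.+ 1) ℕ./ 2) C (N ℕ.∸ D) ℕ.+ (N ℕ.∸ (D ℕ.+ 2) ℕ./ 2) C (N ℕ.∸ D)
  vertex-bound m d V 1≤m vertices = decidable-stable (V ℕ.≤? _)
    (separating-functional v distinct >>= λ (φ , lφ , φ-injective) →
     ¬¬-all {xs = allFin V} (All.universal (λ j → certificate lφ (isVertex j)) (allFin V)) >>= λ certs →
     return (ℕ.≤-trans
       -- The thresholds `D ∸ q₁` and `D ∸ q₂` equal ⌊D/2⌋ and ⌊(D - 1)/2⌋.
       (vertex-count v isVertex {φ} (λ j → All.lookup certs (∈-allFin j)) φ-injective (D ℕ.∸ q₁) (D ℕ.∸ q₂) D≤)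
       (ℕ.≤-reflexive (≡.cong₂ ℕ._+_ (binomial q₁ q₁≤D) (binomial q₂ q₂≤D)))))
    where
    module I = Injection vertices
    v : Fin V → Matrix ℝ (suc m) d
    v j = proj₁ (I.to j)
    isVertex : ∀ j → IsVertex ℝ (v j)
    isVertex j = proj₂ (I.to j)
    distinct : ∀ {i j} → ¬ i ≡ j → ¬ (∀ α → v i α ≈ v j α)
    distinct i≢j vi≈vj = i≢j (I.injective vi≈vj)
    N D q₁ q₂ : ℕ
    N  = suc m ℕ.^ d
    D  = m ℕ.^ d
    q₁ = (D ℕ.+ 1) ℕ./ 2
    q₂ = (D ℕ.+ 2) ℕ./ 2
    D≤N : D ℕ.≤ N
    D≤N = ℕ.^-monoˡ-≤ d (ℕ.n≤1+n m)
    1≤D : 1 ℕ.≤ D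
    1≤D = ℕ.m^n>0 m ⦃ ℕ.>-nonZero 1≤m ⦄ d
    1≤q₁ : 1 ℕ.≤ q₁
    1≤q₁ = ℕ./-monoˡ-≤ 2 (ℕ.+-monoˡ-≤ 1 1≤D)
    q₂≤D : q₂ ℕ.≤ D
    -- Follows from q₁ ≥ 1 and q₁ + q₂ = D + 1; for D = 0 it would fail, with q₂ = 1.
    q₂≤D = ℕ.+-cancelˡ-≤ 1 _ _ (ℕ.≤-trans (ℕ.+-monoˡ-≤ q₂ 1≤q₁) (ℕ.≤-reflexive (halves-sum D)))
    q₁≤D : q₁ ℕ.≤ D
    q₁≤D = ℕ.≤-trans (ℕ./-monoˡ-≤ 2 (ℕ.+-monoʳ-≤ D (ℕ.n≤1+n 1))) q₂≤D
    D≤ : D ℕ.≤ suc ((D ℕ.∸ q₁) ℕ.+ (D ℕ.∸ q₂))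
    D≤ = ℕ.+-cancelˡ-≤ (q₁ ℕ.+ q₂) _ _ (ℕ.≤-reflexive (begin
      (q₁ ℕ.+ q₂) ℕ.+ D                                 ≡⟨ ≡.cong (ℕ._+ D) (halves-sum D) ⟩
      suc (D ℕ.+ D)
        ≡⟨ ≡.cong suc (≡.cong₂ ℕ._+_ (ℕ.m+[n∸m]≡n q₁≤D) (ℕ.m+[n∸m]≡n q₂≤D)) ⟨
      suc ((q₁ ℕ.+ (D ℕ.∸ q₁)) ℕ.+ (q₂ ℕ.+ (D ℕ.∸ q₂)))
        ≡⟨ ≡.cong suc (ℕ-interchange q₁ (D ℕ.∸ q₁) q₂ (D ℕ.∸ q₂)) ⟩
      suc ((q₁ ℕ.+ q₂) ℕ.+ ((D ℕ.∸ q₁) ℕ.+ (D ℕ.∸ q₂)))  ≡⟨ ℕ.+-suc (q₁ ℕ.+ q₂) _ ⟨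
      (q₁ ℕ.+ q₂) ℕ.+ suc ((D ℕ.∸ q₁) ℕ.+ (D ℕ.∸ q₂))    ∎))
      where open ≡.≡-Reasoning
    binomial : ∀ q → q ℕ.≤ D → #monomials (D ℕ.∸ q) (N ℕ.∸ D) ≡ (N ℕ.∸ q) C (N ℕ.∸ D)
    binomial q q≤D = ≡.trans (#monomials≡C (D ℕ.∸ q) (N ℕ.∸ D)) (≡.cong (_C (N ℕ.∸ D)) (begin
      (D ℕ.∸ q) ℕ.+ (N ℕ.∸ D)  ≡⟨ ℕ.+-∸-comm (N ℕ.∸ D) q≤D ⟨
      (D ℕ.+ (N ℕ.∸ D)) ℕ.∸ q  ≡⟨ ≡.cong (ℕ._∸ q) (ℕ.m+[n∸m]≡n D≤N) ⟩
      N ℕ.∸ q                  ∎))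
      where open ≡.≡-Reasoning

open import Data.Nat using (_+_; _∸_; _^_; _/_; _≤_)
open import Relation.Binary.PropositionalEquality using (setoid)

theorem1 : ∀ {c ℓ} (ℝ : RealNumbers c ℓ) (n d : ℕ) → 3 ≤ n → 2 ≤ d →
    ∀ (V : ℕ) → Injection (setoid (Fin V)) (vertexSetoid ℝ n d) →
    V ≤ ((n ^ d ∸ ((n ∸ 1) ^ d + 1) / 2) C (n ^ d ∸ (n ∸ 1) ^ d))
    + ((n ^ d ∸ ((n ∸ 1) ^ d + 2) / 2) C (n ^ d ∸ (n ∸ 1) ^ d))
theorem1 ℝ (suc m) d (ℕ.s≤s 2≤m) _ V = vertex-bound ℝ m d V (ℕ.≤-trans (ℕ.n≤1+n 1) 2≤m)
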